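{- Let $k$ be a positive integer that cannot be written as the sum of three integer squares. Then for every odd positive integer $n$ there does not exist a skew-symmetric weighing matrix $W(4n,k)$.
   Context: A weighing matrix $W(m,k)$ of order $m$ and weight $k$ is a square matrix $W$ of order $m$ with entries in $\{0,\pm1\}$ such that $WW^{\rm T}=kI_m$. A square matrix $A$ is skew-symmetric if $A^{\rm T}=-A$. -}

module Defs where

open import Data.Nat using (ℕ; zero; suc)
open import Data.Integer using (ℤ; +_; -_; _+_; _*_; 0ℤ; 1ℤ; -1ℤ)
open import Data.Fin using (Fin; zero; suc)
open import Data.Sum using (_⊎_)
open import Data.Product using (_×_; ∃-syntax)
open import Relation.Binary.PropositionalEquality using (_≡_)

Matrix : ℕ → Set
Matrix m = Fin m → Fin m → ℤ

∑ : ∀ {m} → (Fin m → ℤ) → ℤ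
∑ {zero} f = 0ℤ
∑ {suc m} f = f zero + ∑ (λ i → f (suc i))

transpose : ∀ {m} → Matrix m → Matrix m
transpose A i j = A j i

_⊗_ : ∀ {m} → Matrix m → Matrix m → Matrix m
(A ⊗ B) i j = ∑ (λ l → A i l * B l j)

open import Data.Fin using (_≟_)
open import Relation.Nullary using (yes; no)

scalarId : ∀ {m} → ℤ → Matrix m
scalarId k i j with i ≟ j
... | yes _ = k
... | no _ = 0ℤ

Ternary : ℤ → Set
Ternary x = (x ≡ 0ℤ) ⊎ (x ≡ 1ℤ) ⊎ (x ≡ -1ℤ)

IsWeighingMatrix : (m k : ℕ) → Matrix m → Set
IsWeighingMatrix m k W =
  (∀ i j → Ternary (W i j)) × (∀ i j → (W ⊗ transpose W) i j ≡ scalarId (+ k) i j)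

IsSkewSymmetric : ∀ {m} → Matrix m → Set
IsSkewSymmetric A = ∀ i j → transpose A i j ≡ - A i j

SumOfThreeSquares : ℕ → Set
SumOfThreeSquares k = ∃[ a ] ∃[ b ] ∃[ c ] (+ k ≡ a * a + b * b + c * c)

{-# OPTIONS --safe #-}
module Submission where

-- Let K = ℚ(√(− k)). Since W² = − k, the vectors W x + √(− k) x span an eigenspace of W, and as W is
-- skew the form Σ zᵢ² vanishes identically on it: in the 4n-dimensional sum of squares over K it is totally
-- isotropic of half the dimension. Writing k as a rational sum of four squares gives a 4 × 4 matrix M
-- with M Mᵀ = k, whence eight squares form an orthogonal sum of four hyperbolic planes over K. As n = 2t + 1,
-- removing 4t hyperbolic planes leaves four squares over K with a nonzero isotropic vector y + √(− k) x, that is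
-- x, y ∈ ℚ⁴ with x · y = 0 and |y|² = k |x|². The quaternion x̄ y is then pure of norm k |x|⁴, so k is a sum
-- of three rational squares, hence of three integer squares by the Davenport–Cassels descent.

open import Defs
open import Data.Fin as Fin using (Fin; zero; suc; toℕ; fromℕ<; opposite; splitAt; join; _≟_)
open import Data.Fin.Patterns
import Data.Fin.Properties as Finₚ
open import Data.Integer using (ℤ; +_; -[1+_]; -_; _+_; _*_; _-_; ∣_∣; 0ℤ; 1ℤ; _/ℕ_; _%ℕ_)
open import Data.Integer.DivMod using (a≡a%ℕn+[a/ℕn]*n; n%ℕd<d)
import Data.Integer.Properties as ℤₚ
open import Data.Integer.Tactic.RingSolver using (solve-∀)
open import Data.List using (List; []; _∷_; length; map)
import Data.List.Properties as Listₚ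
open import Data.List.Relation.Unary.All as All using (All; []; _∷_)
import Data.List.Relation.Unary.All.Properties as Allₚ
open import Data.Nat as ℕ using (ℕ; zero; suc; NonZero; s≤s; z≤n; s≤s⁻¹)
open import Data.Nat.Divisibility using (_∣_; divides; ∣⇒≤; ∣m+n∣m⇒∣n; quotient-<; quotient>1; n∣m*n)
open import Data.Nat.DivMod using (m%n<n; m≡m%n+[m/n]*n; _%_; _/_)
open import Data.Nat.Induction using (<-rec)
open import Data.Nat.Primality
  using (Prime; prime; prime?; prime⇒nonZero; prime⇒irreducible; euclidsLemma; ¬prime⇒composite; composite)
import Data.Nat.Properties as ℕₚ
import Data.Nat.Tactic.RingSolver as ℕ-solver
open import Data.Product using (∃-syntax; Σ-syntax; _×_; _,_; proj₁; proj₂)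
open import Data.Product.Properties using (≡-dec)
open import Data.Sum using (_⊎_; inj₁; inj₂; [_,_]′)
open import Data.Empty using (⊥)
open import Function using (_∘_; id)
open import Relation.Binary using (tri<; tri≈; tri>)
open import Relation.Binary.PropositionalEquality
open import Relation.Nullary using (¬_; Dec; yes; no; contradiction)
open import Relation.Nullary.Decidable using (decidable-stable)

-- Sums of three squares

-- No vector space over K is formed. A space is the set of integer vectors x killed by a finite list
-- of integer functionals, forms take values in ℤ[√(- k)], and denominators are absorbed into
-- nonzero factors. The eigenspace is parametrised by all of ℤ^(4n) through x, so one equation over
-- K costs two of the 4n integer variables. This fixes the budget: of each hyperbolic plane only one
-- isotropic coordinate may be set to zero. Then 4t planes cost 8t out of 8t + 4 variables; killing
-- both coordinates would cost 16t. Isotropy makes up for the other coordinate: it must vanish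
-- wherever all remaining coordinates do, so a vector of the space that is zero in the coordinates
-- still in play is zero altogether. This invariant takes the place of a dimension count. Which
-- coordinate to kill depends on a question about all vectors of the space. It is not decided; the
-- elimination runs under a double negation, which the negative goal absorbs.

infix 8 _²
_² : ℤ → ℤ
i ² = i * i

square-abs : ∀ i → i ² ≡ + (∣ i ∣ ℕ.* ∣ i ∣)
square-abs (+ n) = sym (ℤₚ.pos-* n n)
square-abs -[1+ n ] = refl

square≡0 : ∀ {i} → i ² ≡ 0ℤ → i ≡ 0ℤ
square≡0 {i} = [ id , id ]′ ∘ ℤₚ.i*j≡0⇒i≡0∨j≡0 i

sum-squares≡0 : ∀ {i j l m} → i ² + j ² + l ² + m ² ≡ 0ℤ → i ≡ 0ℤ × j ≡ 0ℤ × l ≡ 0ℤ × m ≡ 0ℤ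
sum-squares≡0 {i} {j} {l} {m} eq
  = root i (ℕₚ.m+n≡0⇒m≡0 _ ij≡0) , root j (ℕₚ.m+n≡0⇒n≡0 _ ij≡0) , root l (ℕₚ.m+n≡0⇒n≡0 _ ijl≡0) , root m (ℕₚ.m+n≡0⇒n≡0 _ ijlm≡0)
  where
  sum≡ = cong₂ _+_ (cong₂ _+_ (cong₂ _+_ (square-abs i) (square-abs j)) (square-abs l)) (square-abs m)
  ijlm≡0 : ∣ i ∣ ℕ.* ∣ i ∣ ℕ.+ ∣ j ∣ ℕ.* ∣ j ∣ ℕ.+ ∣ l ∣ ℕ.* ∣ l ∣ ℕ.+ ∣ m ∣ ℕ.* ∣ m ∣ ≡ 0
  ijlm≡0 = ℤₚ.+-injective (trans (sym sum≡) eq)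
  ijl≡0 = ℕₚ.m+n≡0⇒m≡0 _ ijlm≡0
  ij≡0 = ℕₚ.m+n≡0⇒m≡0 _ ijl≡0
  root : ∀ i → ∣ i ∣ ℕ.* ∣ i ∣ ≡ 0 → i ≡ 0ℤ
  root i p = square≡0 (trans (square-abs i) (cong +_ p))

-- The natural number `e` certifies |r| ≤ t/2 in a form that can be added up over the three
-- coordinates.
nearest-multiple : ∀ a t .{{_ : NonZero t}} →
  ∃[ u ] ∃[ r ] ∃[ e ] (a ≡ + t * u + r × (+ t) ² ≡ + 4 * r ² + + e)
nearest-multiple a t = u , a - + t * u , ρ ℕ.* σ , split a (+ t * u) , gap
  where
  instance _ = ℕₚ.m*n≢0 2 t
  -- Dividing 2a + t by 2t rounds a/t to a nearest integer. The remainder satisfies ρ - t = 2r, so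
  -- t² - 4r² = ρ (2t - ρ) = ρ σ.
  u = (+ 2 * a + + t) /ℕ (2 ℕ.* t)
  ρ = (+ 2 * a + + t) %ℕ (2 ℕ.* t)
  σ = 2 ℕ.* t ℕ.∸ ρ
  split : ∀ a b → a ≡ b + (a - b)
  split = solve-∀
  2t≡ρ+σ : + 2 * + t ≡ + ρ + + σ
  2t≡ρ+σ = trans (sym (ℤₚ.pos-* 2 t)) (trans (cong +_ (sym (ℕₚ.m+[n∸m]≡n (ℕₚ.<⇒≤ (n%ℕd<d (+ 2 * a + + t) (2 ℕ.* t))))))
    (ℤₚ.pos-+ ρ σ))
  division : + 2 * a + + t ≡ + ρ + u * (+ 2 * + t)
  division = trans (a≡a%ℕn+[a/ℕn]*n (+ 2 * a + + t) (2 ℕ.* t)) (cong (λ z → + ρ + u * z) (ℤₚ.pos-* 2 t))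
  square-gap : ∀ a t u ρ σ → + 2 * a + t ≡ ρ + u * (+ 2 * t) → + 2 * t ≡ ρ + σ →
    t * t ≡ + 4 * ((a - t * u) * (a - t * u)) + ρ * σ
  square-gap a t u ρ σ eq₁ eq₂ = begin
    t * t
      ≡⟨ expand a t u ρ σ ⟩
    + 4 * ((a - t * u) * (a - t * u)) + ρ * σ + ρ * (+ 2 * t - (ρ + σ))
      - (+ 2 * a + t - (ρ + u * (+ 2 * t))) * (+ 2 * (a - t * u) + (ρ - t))
      ≡⟨ cong₂ (λ y z → + 4 * ((a - t * u) * (a - t * u)) + ρ * σ + ρ * y - z * (+ 2 * (a - t * u) + (ρ - t)))
           (ℤₚ.i≡j⇒i-j≡0 eq₂) (ℤₚ.i≡j⇒i-j≡0 eq₁) ⟩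
    + 4 * ((a - t * u) * (a - t * u)) + ρ * σ + ρ * 0ℤ - 0ℤ * (+ 2 * (a - t * u) + (ρ - t))
      ≡⟨ simplify (+ 4 * ((a - t * u) * (a - t * u)) + ρ * σ) ρ (+ 2 * (a - t * u) + (ρ - t)) ⟩
    + 4 * ((a - t * u) * (a - t * u)) + ρ * σ ∎
    where
    open ≡-Reasoning
    expand : ∀ a t u ρ σ → t * t ≡
      + 4 * ((a - t * u) * (a - t * u)) + ρ * σ + ρ * (+ 2 * t - (ρ + σ))
        - (+ 2 * a + t - (ρ + u * (+ 2 * t))) * (+ 2 * (a - t * u) + (ρ - t))
    expand = solve-∀
    simplify : ∀ x y z → x + y * 0ℤ - 0ℤ * z ≡ x
    simplify = solve-∀
  gap : (+ t) ² ≡ + 4 * (a - + t * u) ² + + (ρ ℕ.* σ)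
  gap = trans (square-gap a (+ t) u (+ ρ) (+ σ) division 2t≡ρ+σ) (cong (λ z → + 4 * (a - + t * u) ² + z) (sym (ℤₚ.pos-* ρ σ)))

-- Strong induction on the denominator. Three residues of size at most t/2 have squared length at
-- most 3t²/4, which is less than t², so the next denominator t′ = |r|²/t is smaller than t.
three-squares-descent : ∀ (k : ℕ) t → t ≢ 0 → ∀ a b c → + k * (+ t) ² ≡ a ² + b ² + c ² → SumOfThreeSquares k
three-squares-descent k = <-rec _ step
  where
  Goal : ℕ → Set
  Goal t = t ≢ 0 → ∀ a b c → + k * (+ t) ² ≡ a ² + b ² + c ² → SumOfThreeSquares k

  -- The line from (a,b,c)/t through the nearby lattice point (u,v,w) meets the sphere again in a
  -- point of denominator t′, where t t′ is the squared length of the residue (r₁,r₂,r₃).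
  second : ∀ k t u v w r₁ r₂ r₃ → ℤ
  second k t u v w r₁ r₂ r₃ = k * t - + 2 * (u * (t * u + r₁) + v * (t * v + r₂) + w * (t * w + r₃)) + t * (u * u + v * v + w * w)

  second-denominator : ∀ k t u v w r₁ r₂ r₃ →
    k * (t * t) ≡ (t * u + r₁) * (t * u + r₁) + (t * v + r₂) * (t * v + r₂) + (t * w + r₃) * (t * w + r₃) →
    t * second k t u v w r₁ r₂ r₃ ≡ r₁ * r₁ + r₂ * r₂ + r₃ * r₃
  second-denominator k t u v w r₁ r₂ r₃ eq =
    trans (expand k t u v w r₁ r₂ r₃)
      (trans (cong (λ z → r₁ * r₁ + r₂ * r₂ + r₃ * r₃ + z) (ℤₚ.i≡j⇒i-j≡0 eq)) (ℤₚ.+-identityʳ _))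
    where
    expand : ∀ k t u v w r₁ r₂ r₃ →
      t * (k * t - + 2 * (u * (t * u + r₁) + v * (t * v + r₂) + w * (t * w + r₃)) + t * (u * u + v * v + w * w)) ≡
      r₁ * r₁ + r₂ * r₂ + r₃ * r₃ + (k * (t * t) -
        ((t * u + r₁) * (t * u + r₁) + (t * v + r₂) * (t * v + r₂) + (t * w + r₃) * (t * w + r₃)))
    expand = solve-∀

  -- The points (u,v,w) + λ r on the sphere are given by a quadratic in λ whose roots have product
  -- δ/|r|². One root is 1/t, so the other is δ/t′ because |r|² = t t′; this gives the numerators t′
  -- u + δ r₁ and so on.
  second-point : ∀ k t u v w r₁ r₂ r₃ →
    t * second k t u v w r₁ r₂ r₃ ≡ r₁ * r₁ + r₂ * r₂ + r₃ * r₃ →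
    let t′ = second k t u v w r₁ r₂ r₃ ; δ = u * u + v * v + w * w - k in
    k * t′ ² ≡ (t′ * u + δ * r₁) ² + (t′ * v + δ * r₂) ² + (t′ * w + δ * r₃) ²
  second-point k t u v w r₁ r₂ r₃ eq =
    begin
      k * (t′ * t′) ≡⟨ collect k t U S t′ ⟨
      t′ * t′ * U + t′ * δ * (+ 2 * S) + δ * δ * (t * t′) + (t′ * δ) * (k * t - t * U - + 2 * S - t′)
        ≡⟨ cong₂ (λ y z → t′ * t′ * U + t′ * δ * (+ 2 * S) + δ * δ * y + (t′ * δ) * z) eq (ℤₚ.i≡j⇒i-j≡0 (sym (linear k t u v w r₁ r₂ r₃))) ⟩
      t′ * t′ * U + t′ * δ * (+ 2 * S) + δ * δ * (r₁ * r₁ + r₂ * r₂ + r₃ * r₃) + (t′ * δ) * 0ℤ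
        ≡⟨ squares t′ δ u v w r₁ r₂ r₃ ⟩
      (t′ * u + δ * r₁) * (t′ * u + δ * r₁) + (t′ * v + δ * r₂) * (t′ * v + δ * r₂) + (t′ * w + δ * r₃) * (t′ * w + δ * r₃) ∎
    where
    open ≡-Reasoning
    t′ = second k t u v w r₁ r₂ r₃
    U = u * u + v * v + w * w
    S = u * r₁ + v * r₂ + w * r₃
    δ = U - k
    collect : ∀ k t U S t′ →
      t′ * t′ * U + t′ * (U - k) * (+ 2 * S) + (U - k) * (U - k) * (t * t′)
        + (t′ * (U - k)) * (k * t - t * U - + 2 * S - t′) ≡ k * (t′ * t′)
    collect = solve-∀
    linear : ∀ k t u v w r₁ r₂ r₃ →
      k * t - + 2 * (u * (t * u + r₁) + v * (t * v + r₂) + w * (t * w + r₃)) + t * (u * u + v * v + w * w) ≡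
      k * t - t * (u * u + v * v + w * w) - + 2 * (u * r₁ + v * r₂ + w * r₃)
    linear = solve-∀
    squares : ∀ t′ δ u v w r₁ r₂ r₃ →
      t′ * t′ * (u * u + v * v + w * w) + t′ * δ * (+ 2 * (u * r₁ + v * r₂ + w * r₃))
        + δ * δ * (r₁ * r₁ + r₂ * r₂ + r₃ * r₃) + (t′ * δ) * 0ℤ ≡
      (t′ * u + δ * r₁) * (t′ * u + δ * r₁) + (t′ * v + δ * r₂) * (t′ * v + δ * r₂) + (t′ * w + δ * r₃) * (t′ * w + δ * r₃)
    squares = solve-∀

  -- The new denominator enters as a variable with its equation, so that its sign can be matched on.
  -- Zero means that the point was integral already, positive continues the descent, and negative
  -- contradicts t t′ = |r|².
  conclude : ∀ t .{{_ : NonZero t}} → (∀ {s} → s ℕ.< t → Goal s) → ∀ u v w r₁ r₂ r₃ (n e : ℕ) →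
    + k * (+ t) ² ≡ (+ t * u + r₁) ² + (+ t * v + r₂) ² + (+ t * w + r₃) ² →
    r₁ ² + r₂ ² + r₃ ² ≡ + n →
    3 ℕ.* (t ℕ.* t) ≡ 4 ℕ.* n ℕ.+ e →
    ∀ t′ → + t * t′ ≡ r₁ ² + r₂ ² + r₃ ² →
    ∀ a b c → + k * t′ ² ≡ a ² + b ² + c ² →
    SumOfThreeSquares k
  conclude t rec u v w r₁ r₂ r₃ n e eq norm bound (+ zero) den _ _ _ _
    with r₁≡0 , r₂≡0 , r₃≡0 , _ ← sum-squares≡0 {r₁} {r₂} {r₃} {0ℤ}
      (trans (ℤₚ.+-identityʳ (r₁ ² + r₂ ² + r₃ ²)) (trans (sym den) (ℤₚ.*-zeroʳ (+ t))))
    = u , v , w , ℤₚ.*-cancelʳ-≡ (+ k) (u * u + v * v + w * w) ((+ t) ²) {{ℤₚ.i*j≢0 (+ t) (+ t)}} (begin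
      + k * (+ t) ² ≡⟨ eq ⟩
      (+ t * u + r₁) ² + (+ t * v + r₂) ² + (+ t * w + r₃) ²
        ≡⟨ cong₂ _+_ (cong₂ (λ x y → (+ t * u + x) ² + (+ t * v + y) ²) r₁≡0 r₂≡0) (cong (λ x → (+ t * w + x) ²) r₃≡0) ⟩
      (+ t * u + 0ℤ) ² + (+ t * v + 0ℤ) ² + (+ t * w + 0ℤ) ² ≡⟨ factor (+ t) u v w ⟩
      (u * u + v * v + w * w) * (+ t) ² ∎)
    where
    open ≡-Reasoning
    factor : ∀ t u v w → (t * u + 0ℤ) * (t * u + 0ℤ) + (t * v + 0ℤ) * (t * v + 0ℤ) + (t * w + 0ℤ) * (t * w + 0ℤ)
           ≡ (u * u + v * v + w * w) * (t * t)
    factor = solve-∀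
  conclude t rec u v w r₁ r₂ r₃ n e eq norm bound (+ t′@(suc _)) den a b c point = rec t′<t (λ ()) a b c point
    where
    tt′≡n : t ℕ.* t′ ≡ n
    tt′≡n = ℤₚ.+-injective (trans (ℤₚ.pos-* t t′) (trans den norm))
    t′<t : t′ ℕ.< t
    t′<t = ℕₚ.*-cancelˡ-< t t′ t (ℕₚ.*-cancelˡ-< 4 _ _ (begin-strict
      4 ℕ.* (t ℕ.* t′) ≡⟨ cong (4 ℕ.*_) tt′≡n ⟩
      4 ℕ.* n ≤⟨ ℕₚ.m≤m+n _ e ⟩
      4 ℕ.* n ℕ.+ e ≡⟨ bound ⟨
      3 ℕ.* (t ℕ.* t) <⟨ ℕₚ.*-monoˡ-< (t ℕ.* t) {{ℕₚ.m*n≢0 t t}} (ℕₚ.n<1+n 3) ⟩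
      4 ℕ.* (t ℕ.* t) ∎))
      where open ℕₚ.≤-Reasoning
  conclude (suc _) rec u v w r₁ r₂ r₃ n e eq norm bound -[1+ _ ] den _ _ _ _ with () ← trans den norm

  descend : ∀ t .{{_ : NonZero t}} → (∀ {s} → s ℕ.< t → Goal s) → ∀ u v w r₁ r₂ r₃ (e₁ e₂ e₃ : ℕ) →
    + k * (+ t) ² ≡ (+ t * u + r₁) ² + (+ t * v + r₂) ² + (+ t * w + r₃) ² →
    (+ t) ² ≡ + 4 * r₁ ² + + e₁ → (+ t) ² ≡ + 4 * r₂ ² + + e₂ → (+ t) ² ≡ + 4 * r₃ ² + + e₃ →
    SumOfThreeSquares k
  descend t rec u v w r₁ r₂ r₃ e₁ e₂ e₃ eq g₁ g₂ g₃
    = conclude t rec u v w r₁ r₂ r₃ n (e₁ ℕ.+ e₂ ℕ.+ e₃) eq norm (ℤₚ.+-injective bound)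
        t′ den (t′ * u + δ * r₁) (t′ * v + δ * r₂) (t′ * w + δ * r₃)
        (second-point (+ k) (+ t) u v w r₁ r₂ r₃ den)
    where
    t′ = second (+ k) (+ t) u v w r₁ r₂ r₃
    δ = u * u + v * v + w * w - + k
    den = second-denominator (+ k) (+ t) u v w r₁ r₂ r₃ eq
    n = ∣ r₁ ∣ ℕ.* ∣ r₁ ∣ ℕ.+ ∣ r₂ ∣ ℕ.* ∣ r₂ ∣ ℕ.+ ∣ r₃ ∣ ℕ.* ∣ r₃ ∣
    norm : r₁ ² + r₂ ² + r₃ ² ≡ + n
    norm = cong₂ _+_ (cong₂ _+_ (square-abs r₁) (square-abs r₂)) (square-abs r₃)
    add : ∀ x y z p q r → + 4 * x + p + (+ 4 * y + q) + (+ 4 * z + r) ≡ + 4 * (x + y + z) + (p + q + r)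
    add = solve-∀
    triple : ∀ x → + 3 * x ≡ x + x + x
    triple = solve-∀
    bound : + (3 ℕ.* (t ℕ.* t)) ≡ + (4 ℕ.* n ℕ.+ (e₁ ℕ.+ e₂ ℕ.+ e₃))
    bound = begin
      + (3 ℕ.* (t ℕ.* t)) ≡⟨ ℤₚ.pos-* 3 (t ℕ.* t) ⟩
      + 3 * + (t ℕ.* t) ≡⟨ cong (+ 3 *_) (ℤₚ.pos-* t t) ⟩
      + 3 * (+ t) ² ≡⟨ triple ((+ t) ²) ⟩
      (+ t) ² + (+ t) ² + (+ t) ² ≡⟨ cong₂ _+_ (cong₂ _+_ g₁ g₂) g₃ ⟩
      + 4 * r₁ ² + + e₁ + (+ 4 * r₂ ² + + e₂) + (+ 4 * r₃ ² + + e₃) ≡⟨ add (r₁ ²) (r₂ ²) (r₃ ²) (+ e₁) (+ e₂) (+ e₃) ⟩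
      + 4 * (r₁ ² + r₂ ² + r₃ ²) + + (e₁ ℕ.+ e₂ ℕ.+ e₃) ≡⟨ cong (λ z → + 4 * z + + (e₁ ℕ.+ e₂ ℕ.+ e₃)) norm ⟩
      + 4 * + n + + (e₁ ℕ.+ e₂ ℕ.+ e₃) ≡⟨ cong (_+ + (e₁ ℕ.+ e₂ ℕ.+ e₃)) (ℤₚ.pos-* 4 n) ⟨
      + (4 ℕ.* n ℕ.+ (e₁ ℕ.+ e₂ ℕ.+ e₃)) ∎
      where open ≡-Reasoning

  step : ∀ t → (∀ {s} → s ℕ.< t → Goal s) → Goal t
  step t rec t≢0 a b c eq =
    let instance _ = ℕ.≢-nonZero t≢0
        u , r₁ , e₁ , a≡ , g₁ = nearest-multiple a t
        v , r₂ , e₂ , b≡ , g₂ = nearest-multiple b t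
        w , r₃ , e₃ , c≡ , g₃ = nearest-multiple c t
    in descend t rec u v w r₁ r₂ r₃ e₁ e₂ e₃
         (trans eq (cong₂ _+_ (cong₂ (λ x y → x ² + y ²) a≡ b≡) (cong _² c≡))) g₁ g₂ g₃

-- Rational sums of four squares

-- Otherwise p divides (y - x)(x + y), and both factors lie strictly between 0 and p.
squares-incongruent : ∀ {p x y} (pp : Prime p) → x ℕ.< y → x ℕ.+ y ℕ.< p →
  let instance _ = prime⇒nonZero pp in (x ℕ.* x) % p ≢ (y ℕ.* y) % p
squares-incongruent {p} {x} pp x<y x+y<p eq
  with d , refl ← ℕₚ.m≤n⇒∃[o]m+o≡n (ℕₚ.<⇒≤ x<y)
  = [ p∤d , p∤x+y ]′ (euclidsLemma d (x ℕ.+ y) pp p∣y²-x²)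
  where
  open ≡-Reasoning
  instance _ = prime⇒nonZero pp
  y = x ℕ.+ d
  r = (x ℕ.* x) % p
  a = (x ℕ.* x) / p
  b = (y ℕ.* y) / p
  factor : ∀ x d → x ℕ.* x ℕ.+ d ℕ.* (x ℕ.+ (x ℕ.+ d)) ≡ (x ℕ.+ d) ℕ.* (x ℕ.+ d)
  factor = ℕ-solver.solve-∀
  p∣y²-x² : p ∣ d ℕ.* (x ℕ.+ y)
  p∣y²-x² = ∣m+n∣m⇒∣n (divides b (ℕₚ.+-cancelˡ-≡ r _ _ (begin
    r ℕ.+ (a ℕ.* p ℕ.+ d ℕ.* (x ℕ.+ y)) ≡⟨ ℕₚ.+-assoc r _ _ ⟨
    r ℕ.+ a ℕ.* p ℕ.+ d ℕ.* (x ℕ.+ y) ≡⟨ cong (ℕ._+ d ℕ.* (x ℕ.+ y)) (m≡m%n+[m/n]*n (x ℕ.* x) p) ⟨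
    x ℕ.* x ℕ.+ d ℕ.* (x ℕ.+ y) ≡⟨ factor x d ⟩
    y ℕ.* y ≡⟨ m≡m%n+[m/n]*n (y ℕ.* y) p ⟩
    (y ℕ.* y) % p ℕ.+ b ℕ.* p ≡⟨ cong (ℕ._+ b ℕ.* p) eq ⟨
    r ℕ.+ b ℕ.* p ∎))) (n∣m*n a)
  0<d : 0 ℕ.< d
  0<d = ℕₚ.+-cancelˡ-< x 0 d (subst (ℕ._< y) (sym (ℕₚ.+-identityʳ x)) x<y)
  p∤d : ¬ p ∣ d
  p∤d p∣d = ℕₚ.<⇒≱ x+y<p (ℕₚ.≤-trans (∣⇒≤ {{ℕ.>-nonZero 0<d}} p∣d) (ℕₚ.≤-trans (ℕₚ.m≤n+m d x) (ℕₚ.m≤n+m y x)))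
  p∤x+y : ¬ p ∣ x ℕ.+ y
  p∤x+y p∣ = ℕₚ.<⇒≱ x+y<p (∣⇒≤ {{ℕ.>-nonZero (ℕₚ.≤-trans 0<d (ℕₚ.≤-trans (ℕₚ.m≤n+m d x) (ℕₚ.m≤n+m y x)))}} p∣)

-- Pigeonhole on the h + 1 residues x² and the h + 1 residues −1 − y² modulo p = 2h + 1.
odd-prime-divides : ∀ h → Prime (suc (h ℕ.* 2)) →
  ∃[ x ] ∃[ y ] ∃[ m ] (m ℕ.* suc (h ℕ.* 2) ≡ x ℕ.* x ℕ.+ y ℕ.* y ℕ.+ 1 × 0 ℕ.< m × m ℕ.< suc (h ℕ.* 2))
odd-prime-divides h pp = collision (Finₚ.pigeonhole p<2h+2 (residue ∘ splitAt (suc h)))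
  where
  p = suc (h ℕ.* 2)
  Result = ∃[ x ] ∃[ y ] ∃[ m ] (m ℕ.* p ≡ x ℕ.* x ℕ.+ y ℕ.* y ℕ.+ 1 × 0 ℕ.< m × m ℕ.< p)
  square-residue : Fin (suc h) → Fin p
  square-residue x = fromℕ< (m%n<n (toℕ x ℕ.* toℕ x) p)
  residue : Fin (suc h) ⊎ Fin (suc h) → Fin p
  residue (inj₁ x) = square-residue x
  -- `opposite` is r ↦ p - 1 - r on `Fin p`, hence the residue of -1 - y².
  residue (inj₂ y) = opposite (square-residue y)
  p<2h+2 : p ℕ.< suc h ℕ.+ suc h
  p<2h+2 = ℕₚ.≤-reflexive (double h)
    where
    double : ∀ h → suc (suc (h ℕ.* 2)) ≡ suc h ℕ.+ suc h
    double = ℕ-solver.solve-∀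
  below : ∀ {x y} → x ℕ.< y → y ℕ.≤ h → x ℕ.+ y ℕ.< p
  below {x} {y} x<y y≤h = s≤s (ℕₚ.≤-trans (ℕₚ.+-mono-≤ (ℕₚ.≤-trans (ℕₚ.<⇒≤ x<y) y≤h) y≤h) (ℕₚ.≤-reflexive (double h)))
    where
    double : ∀ h → h ℕ.+ h ≡ h ℕ.* 2
    double = ℕ-solver.solve-∀
  square-residue-injective : ∀ {x y} → square-residue x ≡ square-residue y → x ≡ y
  square-residue-injective {x} {y} eq with ℕₚ.<-cmp (toℕ x) (toℕ y)
    | Finₚ.fromℕ<-injective _ _ (m%n<n (toℕ x ℕ.* toℕ x) p) (m%n<n (toℕ y ℕ.* toℕ y) p) eq
  ... | tri< x<y _ _ | eq′ = contradiction eq′ (squares-incongruent pp x<y (below x<y (s≤s⁻¹ (Finₚ.toℕ<n y))))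
  ... | tri≈ _ x≡y _ | _ = Finₚ.toℕ-injective x≡y
  ... | tri> _ _ y<x | eq′ = contradiction (sym eq′) (squares-incongruent pp y<x (below y<x (s≤s⁻¹ (Finₚ.toℕ<n x))))

  0<h : ∀ h → Prime (suc (h ℕ.* 2)) → 0 ℕ.< h
  0<h zero (prime {{()}} _)
  0<h (suc _) _ = s≤s z≤n

  cross : ∀ x y → square-residue x ≡ opposite (square-residue y) → Result
  cross x y eq = toℕ x , toℕ y , suc (a ℕ.+ b) , sym value , s≤s z≤n , ℕₚ.*-cancelʳ-< _ _ p small
    where
    X = toℕ x ℕ.* toℕ x
    Y = toℕ y ℕ.* toℕ y
    a = X / p
    b = Y / p
    residues : X % p ℕ.+ suc (Y % p) ≡ p
    residues = begin
      X % p ℕ.+ suc (Y % p) ≡⟨ cong₂ (λ i j → i ℕ.+ suc j) (Finₚ.toℕ-fromℕ< (m%n<n X p)) (Finₚ.toℕ-fromℕ< (m%n<n Y p)) ⟨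
      toℕ (square-residue x) ℕ.+ suc (toℕ (square-residue y)) ≡⟨ cong (λ i → toℕ i ℕ.+ suc (toℕ (square-residue y))) eq ⟩
      toℕ (opposite (square-residue y)) ℕ.+ suc (toℕ (square-residue y)) ≡⟨ cong (ℕ._+ suc (toℕ (square-residue y))) (Finₚ.opposite-prop (square-residue y)) ⟩
      (p ℕ.∸ suc (toℕ (square-residue y))) ℕ.+ suc (toℕ (square-residue y)) ≡⟨ ℕₚ.m∸n+n≡m (Finₚ.toℕ<n (square-residue y)) ⟩
      p ∎
      where open ≡-Reasoning
    value : X ℕ.+ Y ℕ.+ 1 ≡ suc (a ℕ.+ b) ℕ.* p
    value = begin
      X ℕ.+ Y ℕ.+ 1 ≡⟨ cong₂ (λ i j → i ℕ.+ j ℕ.+ 1) (m≡m%n+[m/n]*n X p) (m≡m%n+[m/n]*n Y p) ⟩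
      X % p ℕ.+ a ℕ.* p ℕ.+ (Y % p ℕ.+ b ℕ.* p) ℕ.+ 1 ≡⟨ arrange (X % p) (Y % p) a b p ⟩
      X % p ℕ.+ suc (Y % p) ℕ.+ (a ℕ.+ b) ℕ.* p ≡⟨ cong (ℕ._+ (a ℕ.+ b) ℕ.* p) residues ⟩
      p ℕ.+ (a ℕ.+ b) ℕ.* p ∎
      where
      open ≡-Reasoning
      arrange : ∀ r s a b p → r ℕ.+ a ℕ.* p ℕ.+ (s ℕ.+ b ℕ.* p) ℕ.+ 1 ≡ r ℕ.+ suc s ℕ.+ (a ℕ.+ b) ℕ.* p
      arrange = ℕ-solver.solve-∀
    small : suc (a ℕ.+ b) ℕ.* p ℕ.< p ℕ.* p
    small = begin-strict
      suc (a ℕ.+ b) ℕ.* p ≡⟨ value ⟨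
      X ℕ.+ Y ℕ.+ 1 ≤⟨ ℕₚ.+-monoˡ-≤ 1 (ℕₚ.+-mono-≤ (square≤ x) (square≤ y)) ⟩
      -- The difference p² - (2h² + 1) = 2h² + 4h is written with one h split off, which makes it
      -- visibly positive; this is what gives m < p.
      h ℕ.* h ℕ.+ h ℕ.* h ℕ.+ 1 <⟨ ℕₚ.m<m+n _ (ℕₚ.≤-trans (0<h h pp) (ℕₚ.m≤m+n h _)) ⟩
      h ℕ.* h ℕ.+ h ℕ.* h ℕ.+ 1 ℕ.+ (h ℕ.+ (3 ℕ.* h ℕ.+ 2 ℕ.* (h ℕ.* h))) ≡⟨ expand h ⟩
      p ℕ.* p ∎
      where
      open ℕₚ.≤-Reasoning
      square≤ : (i : Fin (suc h)) → toℕ i ℕ.* toℕ i ℕ.≤ h ℕ.* h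
      square≤ i = ℕₚ.*-mono-≤ (s≤s⁻¹ (Finₚ.toℕ<n i)) (s≤s⁻¹ (Finₚ.toℕ<n i))
      expand : ∀ h → h ℕ.* h ℕ.+ h ℕ.* h ℕ.+ 1 ℕ.+ (h ℕ.+ (3 ℕ.* h ℕ.+ 2 ℕ.* (h ℕ.* h))) ≡ suc (h ℕ.* 2) ℕ.* suc (h ℕ.* 2)
      expand = ℕ-solver.solve-∀

  coincide : ∀ s s′ → s ≢ s′ → residue s ≡ residue s′ → Result
  coincide (inj₁ x) (inj₁ x′) s≢s′ eq = contradiction (cong inj₁ (square-residue-injective eq)) s≢s′
  coincide (inj₁ x) (inj₂ y) _ eq = cross x y eq
  coincide (inj₂ y) (inj₁ x) _ eq = cross x y (sym eq)
  coincide (inj₂ y) (inj₂ y′) s≢s′ eq = contradiction (cong inj₂ (square-residue-injective opposite-eq)) s≢s′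
    where
    opposite-eq = trans (sym (Finₚ.opposite-involutive _)) (trans (cong opposite eq) (Finₚ.opposite-involutive _))

  collision : ∃[ i ] ∃[ j ] (i Fin.< j × residue (splitAt (suc h) i) ≡ residue (splitAt (suc h) j)) → Result
  collision (i , j , i<j , eq) = coincide _ _ (Finₚ.<⇒≢ i<j ∘ splitAt-injective) eq
    where
    splitAt-injective : splitAt (suc h) i ≡ splitAt (suc h) j → i ≡ j
    splitAt-injective e = trans (sym (Finₚ.join-splitAt (suc h) (suc h) i))
      (trans (cong (join (suc h) (suc h)) e) (Finₚ.join-splitAt (suc h) (suc h) j))

prime-divides : ∀ {p} → Prime p → ∃[ x ] ∃[ y ] ∃[ m ] (m ℕ.* p ≡ x ℕ.* x ℕ.+ y ℕ.* y ℕ.+ 1 × 0 ℕ.< m × m ℕ.< p)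
prime-divides {p} pp with p % 2 | m%n<n p 2 | m≡m%n+[m/n]*n p 2
... | 0 | _ | eq with prime⇒irreducible pp (divides (p / 2) eq)
...   | inj₂ refl = 1 , 0 , 1 , refl , s≤s z≤n , s≤s (s≤s z≤n)
prime-divides {p} pp | 1 | _ | eq = subst (λ q → ∃[ x ] ∃[ y ] ∃[ m ] (m ℕ.* q ≡ x ℕ.* x ℕ.+ y ℕ.* y ℕ.+ 1 × 0 ℕ.< m × m ℕ.< q))
  (sym eq) (odd-prime-divides (p / 2) (subst Prime eq pp))
prime-divides pp | suc (suc _) | s≤s (s≤s ()) | _

row : (r₀ r₁ r₂ r₃ w x y z : ℤ) → ℤ
row r₀ r₁ r₂ r₃ w x y z = r₀ * w + r₁ * x + r₂ * y + r₃ * z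

-- The rows of left multiplication by the conjugate of the quaternion a + b i + c j + d k.
row₀ row₁ row₂ row₃ : (a b c d w x y z : ℤ) → ℤ
row₀ a b c d = row a b c d
row₁ a b c d = row (- b) a d (- c)
row₂ a b c d = row (- c) (- d) a b
row₃ a b c d = row (- d) c (- b) a

-- The polarised version says that the rows form a similarity for the bilinear form. Besides the
-- multiplicativity of the norm, it serves for scalars in K, where products mix real and imaginary
-- parts.
euler-polarised : ∀ a b c d w x y z w′ x′ y′ z′ →
  row₀ a b c d w x y z * row₀ a b c d w′ x′ y′ z′ + row₁ a b c d w x y z * row₁ a b c d w′ x′ y′ z′ +
  row₂ a b c d w x y z * row₂ a b c d w′ x′ y′ z′ + row₃ a b c d w x y z * row₃ a b c d w′ x′ y′ z′ ≡
  (a ² + b ² + c ² + d ²) * (w * w′ + x * x′ + y * y′ + z * z′)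
euler-polarised = identity
  where
  identity : ∀ a b c d w x y z w′ x′ y′ z′ →
    (a * w + b * x + c * y + d * z) * (a * w′ + b * x′ + c * y′ + d * z′) +
    (- b * w + a * x + d * y + - c * z) * (- b * w′ + a * x′ + d * y′ + - c * z′) +
    (- c * w + - d * x + a * y + b * z) * (- c * w′ + - d * x′ + a * y′ + b * z′) +
    (- d * w + c * x + - b * y + a * z) * (- d * w′ + c * x′ + - b * y′ + a * z′) ≡
    (a * a + b * b + c * c + d * d) * (w * w′ + x * x′ + y * y′ + z * z′)
  identity = solve-∀

euler : ∀ a b c d w x y z →
  row₀ a b c d w x y z ² + row₁ a b c d w x y z ² + row₂ a b c d w x y z ² + row₃ a b c d w x y z ² ≡
  (a ² + b ² + c ² + d ²) * (w ² + x ² + y ² + z ²)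
euler a b c d w x y z = euler-polarised a b c d w x y z w x y z

SumOfFourRationalSquares : ℕ → Set
SumOfFourRationalSquares n = ∃[ m ] ∃[ a ] ∃[ b ] ∃[ c ] ∃[ d ] (m ≢ 0ℤ × + n * m ² ≡ a ² + b ² + c ² + d ²)

*-nonzero : ∀ {i j} → i ≢ 0ℤ → j ≢ 0ℤ → i * j ≢ 0ℤ
*-nonzero {i} i≢0 j≢0 = [ i≢0 , j≢0 ]′ ∘ ℤₚ.i*j≡0⇒i≡0∨j≡0 i

four-squares-* : ∀ m n → SumOfFourRationalSquares m → SumOfFourRationalSquares n → SumOfFourRationalSquares (m ℕ.* n)
four-squares-* m n (e , a , b , c , d , e≢0 , eq) (f , w , x , y , z , f≢0 , eq′) =
  e * f , row₀ a b c d w x y z , row₁ a b c d w x y z , row₂ a b c d w x y z , row₃ a b c d w x y z , *-nonzero e≢0 f≢0 ,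
  (begin
    + (m ℕ.* n) * (e * f) ² ≡⟨ cong (_* (e * f) ²) (ℤₚ.pos-* m n) ⟩
    (+ m * + n) * (e * f) ² ≡⟨ arrange (+ m) (+ n) e f ⟩
    (+ m * e ²) * (+ n * f ²) ≡⟨ cong₂ _*_ eq eq′ ⟩
    (a ² + b ² + c ² + d ²) * (w ² + x ² + y ² + z ²) ≡⟨ euler a b c d w x y z ⟨
    row₀ a b c d w x y z ² + row₁ a b c d w x y z ² + row₂ a b c d w x y z ² + row₃ a b c d w x y z ² ∎)
  where
  open ≡-Reasoning
  arrange : ∀ m n e f → m * n * ((e * f) * (e * f)) ≡ (m * (e * e)) * (n * (f * f))
  arrange = solve-∀

-- As n = m (m n) / m², division is multiplication followed by enlarging the denominator by m.
four-squares-quotient : ∀ m n → 0 ℕ.< m → SumOfFourRationalSquares m → SumOfFourRationalSquares (m ℕ.* n) → SumOfFourRationalSquares n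
four-squares-quotient m n 0<m s t = divide (four-squares-* m (m ℕ.* n) s t)
  where
  arrange : ∀ m n e → n * ((m * e) * (m * e)) ≡ m * (m * n) * (e * e)
  arrange = solve-∀
  divide : SumOfFourRationalSquares (m ℕ.* (m ℕ.* n)) → SumOfFourRationalSquares n
  divide (e , a , b , c , d , e≢0 , eq) = + m * e , a , b , c , d , *-nonzero (ℕₚ.<⇒≢ 0<m ∘ sym ∘ ℤₚ.+-injective) e≢0 , (begin
    + n * (+ m * e) ² ≡⟨ arrange (+ m) (+ n) e ⟩
    + m * (+ m * + n) * e ² ≡⟨ cong (λ i → + m * i * e ²) (ℤₚ.pos-* m n) ⟨
    + m * + (m ℕ.* n) * e ² ≡⟨ cong (_* e ²) (ℤₚ.pos-* m (m ℕ.* n)) ⟨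
    + (m ℕ.* (m ℕ.* n)) * e ² ≡⟨ eq ⟩
    a ² + b ² + c ² + d ² ∎)
    where open ≡-Reasoning

-- A prime p has a multiple m p = x² + y² + 1² + 0² with 0 < m < p. The induction hypothesis covers
-- m, and the quotient of the two sums is p. Composite numbers follow by multiplication.
four-rational-squares : ∀ n → 0 ℕ.< n → SumOfFourRationalSquares n
four-rational-squares = <-rec _ step
  where
  step : ∀ n → (∀ {m} → m ℕ.< n → 0 ℕ.< m → SumOfFourRationalSquares m) → 0 ℕ.< n → SumOfFourRationalSquares n
  step 1 rec 0<n = 1ℤ , 1ℤ , 0ℤ , 0ℤ , 0ℤ , (λ ()) , refl
  step n@(suc (suc _)) rec 0<n with prime? n
  ... | yes pp with x , y , m , eq , 0<m , m<n ← prime-divides pp =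
    four-squares-quotient m n 0<m (rec m<n 0<m) (1ℤ , + x , + y , 1ℤ , 0ℤ , (λ ()) , value)
    where
    open ≡-Reasoning
    value : + (m ℕ.* n) * 1ℤ ² ≡ (+ x) ² + (+ y) ² + 1ℤ ² + 0ℤ ²
    value = begin
      + (m ℕ.* n) * 1ℤ ≡⟨ ℤₚ.*-identityʳ _ ⟩
      + (m ℕ.* n) ≡⟨ cong +_ eq ⟩
      + (x ℕ.* x) + + (y ℕ.* y) + 1ℤ ≡⟨ cong₂ (λ i j → i + j + 1ℤ) (ℤₚ.pos-* x x) (ℤₚ.pos-* y y) ⟩
      (+ x) ² + (+ y) ² + 1ℤ ² ≡⟨ ℤₚ.+-identityʳ _ ⟨
      (+ x) ² + (+ y) ² + 1ℤ ² + 0ℤ ² ∎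
  ... | no ¬pp with composite {d} d<n d∣n@(divides q eq) ← ¬prime⇒composite ¬pp =
    subst SumOfFourRationalSquares (sym eq)
      (four-squares-* q d (rec (quotient-< d∣n) (ℕₚ.<-trans (s≤s z≤n) (quotient>1 d∣n d<n)))
        (rec d<n (ℕₚ.<-trans (s≤s z≤n) (ℕ.nonTrivial⇒n>1 d))))

-- Linear functionals on ℤⁿ

∑-cong : ∀ {m} {f g : Fin m → ℤ} → (∀ i → f i ≡ g i) → ∑ f ≡ ∑ g
∑-cong {zero} _ = refl
∑-cong {suc _} eq = cong₂ _+_ (eq zero) (∑-cong (eq ∘ suc))

∑-zero : ∀ {m} (f : Fin m → ℤ) → (∀ i → f i ≡ 0ℤ) → ∑ f ≡ 0ℤ
∑-zero {zero} f _ = refl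
∑-zero {suc _} f eq = cong₂ _+_ (eq zero) (∑-zero (f ∘ suc) (eq ∘ suc))

∑-+ : ∀ {m} (f g : Fin m → ℤ) → ∑ (λ i → f i + g i) ≡ ∑ f + ∑ g
∑-+ {zero} f g = refl
∑-+ {suc _} f g = trans (cong (_+_ (f zero + g zero)) (∑-+ (f ∘ suc) (g ∘ suc)))
  (interchange (f zero) (g zero) (∑ (f ∘ suc)) (∑ (g ∘ suc)))
  where
  interchange : ∀ a b c d → a + b + (c + d) ≡ a + c + (b + d)
  interchange = solve-∀

∑-* : ∀ {m} a (f : Fin m → ℤ) → ∑ (λ i → a * f i) ≡ a * ∑ f
∑-* {zero} a f = sym (ℤₚ.*-zeroʳ a)
∑-* {suc _} a f = trans (cong (_+_ (a * f zero)) (∑-* a (f ∘ suc))) (sym (ℤₚ.*-distribˡ-+ a (f zero) (∑ (f ∘ suc))))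

∑-swap : ∀ {m n} (f : Fin m → Fin n → ℤ) → ∑ (λ i → ∑ (λ j → f i j)) ≡ ∑ (λ j → ∑ (λ i → f i j))
∑-swap {zero} {n} f = sym (∑-zero {n} (λ _ → 0ℤ) (λ _ → refl))
∑-swap {suc _} f = trans (cong (_+_ (∑ (f zero))) (∑-swap (f ∘ suc))) (sym (∑-+ (f zero) (λ j → ∑ (λ i → f (suc i) j))))

Vector : ℕ → Set
Vector n = Fin n → ℤ

Zero : ∀ {n} → Vector n → Set
Zero x = ∀ i → x i ≡ 0ℤ

Linear : ∀ {n} → (Vector n → ℤ) → Set
Linear {n} f = Σ[ c ∈ Vector n ] (∀ (x : Vector n) → f x ≡ ∑ (λ i → c i * x i))

linear-cong : ∀ {n} {f g : Vector n → ℤ} → (∀ x → f x ≡ g x) → Linear g → Linear f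
linear-cong f≗g (c , eq) = c , λ x → trans (f≗g x) (eq x)

linear-zero : ∀ {n} → Linear {n} (λ _ → 0ℤ)
linear-zero = (λ _ → 0ℤ) , λ x → sym (∑-zero (λ i → 0ℤ * x i) (λ _ → refl))

linear-+ : ∀ {n} {f g : Vector n → ℤ} → Linear f → Linear g → Linear (λ x → f x + g x)
linear-+ (c , f≡) (d , g≡) = (λ i → c i + d i) , λ x → trans (cong₂ _+_ (f≡ x) (g≡ x))
  (trans (sym (∑-+ (λ i → c i * x i) (λ i → d i * x i))) (∑-cong (λ i → sym (ℤₚ.*-distribʳ-+ (x i) (c i) (d i)))))

linear-* : ∀ {n} a {f : Vector n → ℤ} → Linear f → Linear (λ x → a * f x)
linear-* a (c , f≡) = (λ i → a * c i) , λ x → trans (cong (a *_) (f≡ x))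
  (trans (sym (∑-* a (λ i → c i * x i))) (∑-cong (λ i → sym (ℤₚ.*-assoc a (c i) (x i)))))

linear-neg : ∀ {n} {f : Vector n → ℤ} → Linear f → Linear (λ x → - f x)
linear-neg {f = f} l = linear-cong (λ x → sym (ℤₚ.-1*i≡-i (f x))) (linear-* (- 1ℤ) l)

linear-- : ∀ {n} {f g : Vector n → ℤ} → Linear f → Linear g → Linear (λ x → f x - g x)
linear-- l l′ = linear-+ l (linear-neg l′)

linear-∑ : ∀ {m n} (f : Fin m → Vector n → ℤ) → (∀ i → Linear (f i)) → Linear (λ x → ∑ (λ i → f i x))
linear-∑ {zero} f _ = linear-zero
linear-∑ {suc _} f l = linear-+ (l zero) (linear-∑ (f ∘ suc) (l ∘ suc))

linear-tail : ∀ {n} {f : Vector n → ℤ} → Linear f → Linear (λ x → f (x ∘ suc))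
linear-tail (c , f≡) = (λ { zero → 0ℤ ; (suc i) → c i }) , λ x → trans (f≡ (x ∘ suc)) (sym (ℤₚ.+-identityˡ _))

linear-coordinate : ∀ {n} (i : Fin n) → Linear (λ x → x i)
linear-coordinate {suc n} zero = (λ { zero → 1ℤ ; (suc _) → 0ℤ }) , λ x →
  sym (trans (cong₂ _+_ (ℤₚ.*-identityˡ (x zero)) (∑-zero {n} (λ _ → 0ℤ) (λ _ → refl))) (ℤₚ.+-identityʳ (x zero)))
linear-coordinate (suc i) = linear-tail (linear-coordinate i)

linear-∘ : ∀ {m n} {f : Vector m → ℤ} (g : Vector n → Vector m) → Linear f → (∀ i → Linear (λ x → g x i)) → Linear (f ∘ g)
linear-∘ g (c , f≡) l = linear-cong (f≡ ∘ g) (linear-∑ (λ i x → c i * g x i) (λ i → linear-* (c i) (l i)))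

-- Elimination without fractions: the free coordinates are multiplied by the pivot instead of
-- dividing the dependent one. The image need not be the whole solution lattice; injectivity is
-- enough to keep solutions nonzero.
hyperplane : ∀ {n} (c : Vector (suc n)) → ∃[ g ] (
  (∀ (y : Vector n) → ∑ (λ i → c i * g y i) ≡ 0ℤ) × (∀ i → Linear (λ y → g y i)) × (∀ y → Zero (g y) → Zero y))
hyperplane c with c zero ℤₚ.≟ 0ℤ
hyperplane {n} c | no c₀≢0 = g , vanish , linear , injective
  where
  s : Vector n → ℤ
  s y = ∑ (λ i → c (suc i) * y i)
  g : Vector n → Vector (suc n)
  g y zero = - s y
  g y (suc i) = c zero * y i
  swap : ∀ a b z → a * (b * z) ≡ b * (a * z)
  swap = solve-∀
  cancel : ∀ a b → a * - b + a * b ≡ 0ℤ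
  cancel = solve-∀
  vanish : ∀ y → c zero * - s y + ∑ (λ i → c (suc i) * (c zero * y i)) ≡ 0ℤ
  vanish y = trans (cong (_+_ (c zero * - s y)) (trans (∑-cong (λ i → swap (c (suc i)) (c zero) (y i)))
      (∑-* (c zero) (λ i → c (suc i) * y i))))
    (cancel (c zero) (s y))
  linear : ∀ i → Linear (λ y → g y i)
  linear zero = linear-neg ((c ∘ suc) , λ _ → refl)
  linear (suc i) = linear-* (c zero) (linear-coordinate i)
  injective : ∀ y → Zero (g y) → Zero y
  injective y z i = [ (λ e → contradiction e c₀≢0) , id ]′ (ℤₚ.i*j≡0⇒i≡0∨j≡0 (c zero) (z (suc i)))
-- Reached only if every coefficient is zero: the last coordinate is then sacrificed, so that
-- exactly one variable is lost in every case.
hyperplane {zero} c | yes c₀≡0 = (λ _ _ → 0ℤ) , (λ _ → trans (ℤₚ.+-identityʳ _) (ℤₚ.*-zeroʳ (c zero))) , (λ _ → linear-zero) , λ _ _ ()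
hyperplane {suc n} c | yes c₀≡0 with h , vanish′ , linear′ , injective′ ← hyperplane (c ∘ suc) = g , vanish , linear , injective
  where
  g : Vector (suc n) → Vector (suc (suc n))
  g y zero = y zero
  g y (suc i) = h (y ∘ suc) i
  vanish : ∀ y → c zero * y zero + ∑ (λ i → c (suc i) * h (y ∘ suc) i) ≡ 0ℤ
  vanish y = cong₂ _+_ (cong (_* y zero) c₀≡0) (vanish′ (y ∘ suc))
  linear : ∀ i → Linear (λ y → g y i)
  linear zero = linear-coordinate zero
  linear (suc i) = linear-tail (linear′ i)
  injective : ∀ y → Zero (g y) → Zero y
  injective y z zero = z zero
  injective y z (suc i) = injective′ (y ∘ suc) (z ∘ suc) i

Kernel : ∀ {n} → List (Vector n → ℤ) → Vector n → Set
Kernel fs x = All (λ f → f x ≡ 0ℤ) fs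

-- Each equation is traded for one variable by substituting the parametrisation of its hyperplane
-- into the others.
underdetermined-system : ∀ {n} (fs : List (Vector n → ℤ)) → All Linear fs → length fs ℕ.< n →
  ∃[ x ] (Kernel fs x × ¬ Zero x)
underdetermined-system [] [] (s≤s _) = (λ _ → 1ℤ) , [] , λ z → contradiction (z zero) λ ()
underdetermined-system (f ∷ fs) ((c , f≡) ∷ ls) (s≤s m<n)
  with g , vanish , linear , injective ← hyperplane c
  with y , ker , y≢0 ← underdetermined-system (map (_∘ g) fs)
         (Allₚ.map⁺ (All.map (λ l → linear-∘ g l linear) ls)) (subst (ℕ._< _) (sym (Listₚ.length-map (_∘ g) fs)) m<n)
  = g y , trans (f≡ (g y)) (vanish y) ∷ Allₚ.map⁻ ker , y≢0 ∘ injective y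

linear-row : ∀ {n} r₀ r₁ r₂ r₃ {f₀ f₁ f₂ f₃ : Vector n → ℤ} → Linear f₀ → Linear f₁ → Linear f₂ → Linear f₃ →
  Linear (λ x → row r₀ r₁ r₂ r₃ (f₀ x) (f₁ x) (f₂ x) (f₃ x))
linear-row r₀ r₁ r₂ r₃ l₀ l₁ l₂ l₃ =
  linear-+ (linear-+ (linear-+ (linear-* r₀ l₀) (linear-* r₁ l₁)) (linear-* r₂ l₂)) (linear-* r₃ l₃)

difference-sum≡0 : ∀ i j → i - j ≡ 0ℤ → i + j ≡ 0ℤ → i ≡ 0ℤ × j ≡ 0ℤ
difference-sum≡0 i j i-j≡0 i+j≡0 = i≡0 , trans (sym (ℤₚ.i-j≡0⇒i≡j i j i-j≡0)) i≡0
  where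
  double : ∀ i j → + 2 * i ≡ (i - j) + (i + j)
  double = solve-∀
  i≡0 : i ≡ 0ℤ
  i≡0 = [ (λ ()) , id ]′ (ℤₚ.i*j≡0⇒i≡0∨j≡0 (+ 2) (trans (double i j) (cong₂ _+_ i-j≡0 i+j≡0)))

-- The bilinear identities of a skew weighing matrix

∑-scalarId : ∀ {m} κ (y : Vector m) l → ∑ (λ j → y j * scalarId κ j l) ≡ y l * κ
∑-scalarId {suc m} κ y zero = trans (cong (_+_ (y zero * κ)) (∑-zero (λ j → y (suc j) * 0ℤ) (λ j → ℤₚ.*-zeroʳ (y (suc j)))))
  (ℤₚ.+-identityʳ (y zero * κ))
∑-scalarId {suc m} κ y (suc l) = trans (cong₂ _+_ (ℤₚ.*-zeroʳ (y zero))
  (trans (∑-cong (λ j → cong (y (suc j) *_) (scalarId-suc j))) (∑-scalarId κ (y ∘ suc) l))) (ℤₚ.+-identityˡ (y (suc l) * κ))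
  where
  scalarId-suc : ∀ j → scalarId κ (suc j) (suc l) ≡ scalarId κ j l
  scalarId-suc j with j ≟ l
  ... | yes _ = refl
  ... | no _ = refl

_·_ : ∀ {m} → Matrix m → Vector m → Vector m
(A · x) i = ∑ (λ l → A i l * x l)

∑-adjoint : ∀ {m} (A : Matrix m) (x u : Vector m) → ∑ (λ i → (A · x) i * u i) ≡ ∑ (λ l → x l * ∑ (λ i → A i l * u i))
∑-adjoint A x u = begin
  ∑ (λ i → ∑ (λ l → A i l * x l) * u i)
    ≡⟨ ∑-cong (λ i → trans (ℤₚ.*-comm ((A · x) i) (u i)) (sym (∑-* (u i) (λ l → A i l * x l)))) ⟩
  ∑ (λ i → ∑ (λ l → u i * (A i l * x l))) ≡⟨ ∑-swap (λ i l → u i * (A i l * x l)) ⟩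
  ∑ (λ l → ∑ (λ i → u i * (A i l * x l)))
    ≡⟨ ∑-cong (λ l → trans (∑-cong (λ i → rotate (u i) (A i l) (x l))) (∑-* (x l) (λ i → A i l * u i))) ⟩
  ∑ (λ l → x l * ∑ (λ i → A i l * u i)) ∎
  where
  open ≡-Reasoning
  rotate : ∀ u a x → u * (a * x) ≡ x * (a * u)
  rotate = solve-∀

∑-neg : ∀ {m} (f : Fin m → ℤ) → ∑ (λ i → - f i) ≡ - ∑ f
∑-neg f = trans (∑-cong (λ i → sym (ℤₚ.-1*i≡-i (f i)))) (trans (∑-* (- 1ℤ) f) (ℤₚ.-1*i≡-i (∑ f)))

-- The imaginary part of Σ zᵢ(x) zᵢ(y) for z(x) = W x + √(- k) x. Moving W across the product
-- changes the sign.
skew-form : ∀ {m} {W : Matrix m} → IsSkewSymmetric W → ∀ x y → ∑ (λ i → (W · x) i * y i + x i * (W · y) i) ≡ 0ℤ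
skew-form {W = W} skew x y = begin
  ∑ (λ i → (W · x) i * y i + x i * (W · y) i) ≡⟨ ∑-+ (λ i → (W · x) i * y i) (λ i → x i * (W · y) i) ⟩
  ∑ (λ i → (W · x) i * y i) + ∑ (λ i → x i * (W · y) i) ≡⟨ cong (_+ ∑ (λ i → x i * (W · y) i)) (∑-adjoint W x y) ⟩
  ∑ (λ l → x l * ∑ (λ i → W i l * y i)) + ∑ (λ i → x i * (W · y) i) ≡⟨ cong (_+ ∑ (λ i → x i * (W · y) i)) (∑-cong transposed) ⟩
  ∑ (λ l → - (x l * (W · y) l)) + ∑ (λ i → x i * (W · y) i) ≡⟨ cong (_+ ∑ (λ i → x i * (W · y) i)) (∑-neg (λ l → x l * (W · y) l)) ⟩
  - ∑ (λ l → x l * (W · y) l) + ∑ (λ i → x i * (W · y) i) ≡⟨ ℤₚ.+-inverseˡ (∑ (λ i → x i * (W · y) i)) ⟩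
  0ℤ ∎
  where
  open ≡-Reasoning
  transposed : ∀ l → x l * ∑ (λ i → W i l * y i) ≡ - (x l * (W · y) l)
  transposed l = begin
    x l * ∑ (λ i → W i l * y i) ≡⟨ cong (x l *_) (∑-cong (λ i → cong (_* y i) (skew l i))) ⟩
    x l * ∑ (λ i → - W l i * y i) ≡⟨ cong (x l *_) (∑-cong (λ i → sym (ℤₚ.neg-distribˡ-* (W l i) (y i)))) ⟩
    x l * ∑ (λ i → - (W l i * y i)) ≡⟨ cong (x l *_) (∑-neg (λ i → W l i * y i)) ⟩
    x l * - (W · y) l ≡⟨ ℤₚ.neg-distribʳ-* (x l) ((W · y) l) ⟨
    - (x l * (W · y) l) ∎

-- The real part of the same bilinear form. It amounts to Wᵀ W = k, a statement about columns,
-- whereas the weighing condition concerns rows.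
weighing-form : ∀ {m k} {W : Matrix m} → IsWeighingMatrix m k W → IsSkewSymmetric W →
  ∀ x y → ∑ (λ i → (W · x) i * (W · y) i - + k * (x i * y i)) ≡ 0ℤ
weighing-form {m} {k} {W} (_ , WWᵀ≡k) skew x y = begin
  ∑ (λ i → (W · x) i * (W · y) i - + k * (x i * y i)) ≡⟨ ∑-+ (λ i → (W · x) i * (W · y) i) (λ i → - (+ k * (x i * y i))) ⟩
  ∑ (λ i → (W · x) i * (W · y) i) + ∑ (λ i → - (+ k * (x i * y i)))
    ≡⟨ cong₂ _+_ (∑-adjoint W x (W · y)) (∑-neg (λ i → + k * (x i * y i))) ⟩
  ∑ (λ l → x l * ∑ (λ i → W i l * (W · y) i)) - ∑ (λ l → + k * (x l * y l))
    ≡⟨ cong (_- ∑ (λ l → + k * (x l * y l))) (∑-cong (λ l → trans (cong (x l *_) (square l)) (rotate (x l) (y l) (+ k)))) ⟩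
  ∑ (λ l → + k * (x l * y l)) - ∑ (λ l → + k * (x l * y l)) ≡⟨ ℤₚ.+-inverseʳ (∑ (λ l → + k * (x l * y l))) ⟩
  0ℤ ∎
  where
  open ≡-Reasoning
  rotate : ∀ x y k → x * (y * k) ≡ k * (x * y)
  rotate = solve-∀
  -- Passing from columns to rows costs one sign for each factor, and the two cancel.
  signs : ∀ i j l → W i j * W i l ≡ W j i * W l i
  signs i j l = trans (cong₂ _*_ (skew j i) (skew l i)) (cancel (W j i) (W l i))
    where
    cancel : ∀ a b → - a * - b ≡ a * b
    cancel = solve-∀
  square : ∀ l → ∑ (λ i → W i l * (W · y) i) ≡ y l * + k
  square l = begin
    ∑ (λ i → W i l * (W · y) i) ≡⟨ ∑-cong (λ i → ℤₚ.*-comm (W i l) ((W · y) i)) ⟩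
    ∑ (λ i → (W · y) i * W i l) ≡⟨ ∑-adjoint W y (λ i → W i l) ⟩
    ∑ (λ j → y j * ∑ (λ i → W i j * W i l))
    ≡⟨ ∑-cong (λ j → cong (y j *_) (trans (∑-cong (λ i → signs i j l)) (WWᵀ≡k j l))) ⟩
    ∑ (λ j → y j * scalarId (+ k) j l) ≡⟨ ∑-scalarId (+ k) y l ⟩
    y l * + k ∎

-- Three squares from an orthogonal pair in ℤ⁴

orthogonal-similar⇒three-squares : ∀ k x₀ x₁ x₂ x₃ y₀ y₁ y₂ y₃ →
  x₀ * y₀ + x₁ * y₁ + x₂ * y₂ + x₃ * y₃ ≡ 0ℤ →
  y₀ ² + y₁ ² + y₂ ² + y₃ ² ≡ + k * (x₀ ² + x₁ ² + x₂ ² + x₃ ²) →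
  x₀ ² + x₁ ² + x₂ ² + x₃ ² ≢ 0ℤ → SumOfThreeSquares k
orthogonal-similar⇒three-squares k x₀ x₁ x₂ x₃ y₀ y₁ y₂ y₃ x·y≡0 y²≡kx² x²≢0 =
  three-squares-descent k n (λ n≡0 → x²≢0 (trans x²≡n (cong +_ n≡0))) r₁ r₂ r₃ (begin
    + k * (+ n) ² ≡⟨ cong (λ i → + k * i ²) x²≡n ⟨
    + k * X ² ≡⟨ rotate (+ k) X ⟩
    X * (+ k * X) ≡⟨ cong (X *_) y²≡kx² ⟨
    X * (y₀ ² + y₁ ² + y₂ ² + y₃ ²) ≡⟨ euler x₀ x₁ x₂ x₃ y₀ y₁ y₂ y₃ ⟨
    row₀ x₀ x₁ x₂ x₃ y₀ y₁ y₂ y₃ ² + r₁ ² + r₂ ² + r₃ ² ≡⟨ cong (λ i → i ² + r₁ ² + r₂ ² + r₃ ²) x·y≡0 ⟩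
    0ℤ + r₁ ² + r₂ ² + r₃ ² ≡⟨ cong (λ i → i + r₂ ² + r₃ ²) (ℤₚ.+-identityˡ (r₁ ²)) ⟩
    r₁ ² + r₂ ² + r₃ ² ∎)
  where
  open ≡-Reasoning
  X = x₀ ² + x₁ ² + x₂ ² + x₃ ²
  r₁ = row₁ x₀ x₁ x₂ x₃ y₀ y₁ y₂ y₃
  r₂ = row₂ x₀ x₁ x₂ x₃ y₀ y₁ y₂ y₃
  r₃ = row₃ x₀ x₁ x₂ x₃ y₀ y₁ y₂ y₃
  n = ∣ x₀ ∣ ℕ.* ∣ x₀ ∣ ℕ.+ ∣ x₁ ∣ ℕ.* ∣ x₁ ∣ ℕ.+ ∣ x₂ ∣ ℕ.* ∣ x₂ ∣ ℕ.+ ∣ x₃ ∣ ℕ.* ∣ x₃ ∣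
  x²≡n : X ≡ + n
  x²≡n = cong₂ _+_ (cong₂ _+_ (cong₂ _+_ (square-abs x₀) (square-abs x₁)) (square-abs x₂)) (square-abs x₃)
  rotate : ∀ k x → k * (x * x) ≡ x * (k * x)
  rotate = solve-∀

-- Isotropic vectors over ℚ(√(− k))

module ImaginaryQuadratic (k : ℕ) (0<k : 0 ℕ.< k) where

  -- (a , b) stands for a + b √(− k).
  K : Set
  K = ℤ × ℤ

  0K : K
  0K = 0ℤ , 0ℤ

  infixl 6 _⊕_
  infixl 7 _⊙_
  _⊕_ _⊙_ : K → K → K
  (a , b) ⊕ (c , d) = a + c , b + d
  (a , b) ⊙ (c , d) = a * c - + k * (b * d) , a * d + b * c

  _≟K_ : (u v : K) → Dec (u ≡ v)
  _≟K_ = ≡-dec ℤₚ._≟_ ℤₚ._≟_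

  ⊕-identityʳ : ∀ u → u ⊕ 0K ≡ u
  ⊕-identityʳ (a , b) = cong₂ _,_ (ℤₚ.+-identityʳ a) (ℤₚ.+-identityʳ b)

  ⊕-identityˡ : ∀ u → 0K ⊕ u ≡ u
  ⊕-identityˡ (a , b) = cong₂ _,_ (ℤₚ.+-identityˡ a) (ℤₚ.+-identityˡ b)

  ⊙-zeroˡ : ∀ u → 0K ⊙ u ≡ 0K
  ⊙-zeroˡ (a , b) = cong₂ _,_ (real a b (+ k)) (imaginary a b)
    where
    real : ∀ a b k → 0ℤ * a - k * (0ℤ * b) ≡ 0ℤ
    real = solve-∀
    imaginary : ∀ a b → 0ℤ * b + 0ℤ * a ≡ 0ℤ
    imaginary = solve-∀

  ⊙-zeroʳ : ∀ u → u ⊙ 0K ≡ 0K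
  ⊙-zeroʳ (a , b) = cong₂ _,_ (real a b (+ k)) (imaginary a b)
    where
    real : ∀ a b k → a * 0ℤ - k * (b * 0ℤ) ≡ 0ℤ
    real = solve-∀
    imaginary : ∀ a b → a * 0ℤ + b * 0ℤ ≡ 0ℤ
    imaginary = solve-∀

  k≢0 : + k ≢ 0ℤ
  k≢0 = ℕₚ.<⇒≢ 0<k ∘ sym ∘ ℤₚ.+-injective

  norm≡0 : ∀ c d → c ² + + k * d ² ≡ 0ℤ → (c , d) ≡ 0K
  norm≡0 c d eq = cong₂ _,_ c≡0 d≡0
    where
    c² = ∣ c ∣ ℕ.* ∣ c ∣
    d² = ∣ d ∣ ℕ.* ∣ d ∣
    eq′ : c² ℕ.+ k ℕ.* d² ≡ 0
    eq′ = ℤₚ.+-injective (begin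
      + (c² ℕ.+ k ℕ.* d²) ≡⟨ ℤₚ.pos-+ c² (k ℕ.* d²) ⟩
      + c² + + (k ℕ.* d²) ≡⟨ cong (_+_ (+ c²)) (ℤₚ.pos-* k d²) ⟩
      + c² + + k * + d² ≡⟨ cong₂ (λ i j → i + + k * j) (square-abs c) (square-abs d) ⟨
      c ² + + k * d ² ≡⟨ eq ⟩
      0ℤ ∎)
      where open ≡-Reasoning
    c≡0 : c ≡ 0ℤ
    c≡0 = square≡0 (trans (square-abs c) (cong +_ (ℕₚ.m+n≡0⇒m≡0 c² eq′)))
    d≡0 : d ≡ 0ℤ
    d≡0 = square≡0 (trans (square-abs d) (cong +_ ([ (λ k≡0 → contradiction (cong +_ k≡0) k≢0) , id ]′
      (ℕₚ.m*n≡0⇒m≡0∨n≡0 k (ℕₚ.m+n≡0⇒n≡0 c² eq′)))))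

  -- Multiplying by the conjugate of `v` replaces `v` by its norm c² + k d², which is definite
  -- because k is positive.
  ⊙-cancelʳ : ∀ u v → v ≢ 0K → u ⊙ v ≡ 0K → u ≡ 0K
  ⊙-cancelʳ (a , b) (c , d) v≢0 eq = cong₂ _,_ (divide a (cofactor₁ a b (cong proj₁ eq) (cong proj₂ eq)))
    (divide b (cofactor₂ a b (cong proj₁ eq) (cong proj₂ eq)))
    where
    norm = c ² + + k * d ²
    divide : ∀ x → x * norm ≡ 0ℤ → x ≡ 0ℤ
    divide x e = [ id , (λ n≡0 → contradiction (norm≡0 c d n≡0) v≢0) ]′ (ℤₚ.i*j≡0⇒i≡0∨j≡0 x e)
    cofactor₁ : ∀ a b → a * c - + k * (b * d) ≡ 0ℤ → a * d + b * c ≡ 0ℤ → a * norm ≡ 0ℤ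
    cofactor₁ a b real imaginary = trans (expand a b c d (+ k)) (trans (cong₂ (λ x y → x * c + + k * d * y) real imaginary) (simplify c d (+ k)))
      where
      expand : ∀ a b c d k → a * (c * c + k * (d * d)) ≡ (a * c - k * (b * d)) * c + k * d * (a * d + b * c)
      expand = solve-∀
      simplify : ∀ c d k → 0ℤ * c + k * d * 0ℤ ≡ 0ℤ
      simplify = solve-∀
    cofactor₂ : ∀ a b → a * c - + k * (b * d) ≡ 0ℤ → a * d + b * c ≡ 0ℤ → b * norm ≡ 0ℤ
    cofactor₂ a b real imaginary = trans (expand a b c d (+ k)) (trans (cong₂ (λ x y → y * c - x * d) real imaginary) (simplify c d))
      where
      expand : ∀ a b c d k → b * (c * c + k * (d * d)) ≡ (a * d + b * c) * c - (a * c - k * (b * d)) * d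
      expand = solve-∀
      simplify : ∀ c d → 0ℤ * c - 0ℤ * d ≡ 0ℤ
      simplify = solve-∀

  Functional : ℕ → Set
  Functional n = Vector n → K

  -- Linearity over ℤ suffices, since spaces are cut out by integer constraints; one equation over K
  -- contributes two of them.
  LinearK : ∀ {n} → Functional n → Set
  LinearK f = Linear (proj₁ ∘ f) × Linear (proj₂ ∘ f)

  Form : ℕ → Set
  Form n = Vector n → Vector n → K

  Plane : ℕ → Set
  Plane n = Functional n × Functional n

  hyperbolic : ∀ {n} → Plane n → Form n
  hyperbolic (p , q) x y = p x ⊙ q y ⊕ q x ⊙ p y

  infixr 4 _⟂_
  _⟂_ : ∀ {n} → List (Plane n) → Form n → Form n
  ([] ⟂ B) x y = B x y
  (P ∷ Ps ⟂ B) x y = hyperbolic P x y ⊕ (Ps ⟂ B) x y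

  VanishAt : ∀ {n} → Vector n → Plane n → Set
  VanishAt x (p , q) = p x ≡ 0K × q x ≡ 0K

  LinearPlane : ∀ {n} → Plane n → Set
  LinearPlane (p , q) = LinearK p × LinearK q

  -- Z x is meant to say that all coordinates entering the form B vanish at x.
  record Isotropic {n} (constraints : List (Vector n → ℤ)) (B : Form n) (Z : Vector n → Set) : Set where
    field
      linear : All Linear constraints
      isotropic : ∀ x y → Kernel constraints x → Kernel constraints y → B x y ≡ 0K
      injective : ∀ x → Kernel constraints x → Z x → Zero x

  open Isotropic

  -- If p does not vanish identically, p = 0 is imposed: a vector v with p v = 0 and no component off the
  -- plane is orthogonal to some u with p u ≠ 0, which forces q v = 0. Otherwise q = 0 is imposed.
  remove-plane : ∀ {n A} {B : Form n} {Z} p q → LinearK p → LinearK q → (∀ x y → Z x → B x y ≡ 0K) →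
    Isotropic A (λ x y → hyperbolic (p , q) x y ⊕ B x y) (λ x → VanishAt x (p , q) × Z x) →
    ¬ ¬ (∃[ A′ ] (length A′ ≡ 2 ℕ.+ length A × Isotropic A′ B Z))
  remove-plane {n} {A} {B} {Z} p q (lp₁ , lp₂) (lq₁ , lq₂) Z⇒B≡0 iso none =
    none ((proj₁ ∘ q) ∷ (proj₂ ∘ q) ∷ A , refl , record
      { linear = lq₁ ∷ lq₂ ∷ linear iso
      ; isotropic = λ { x y (_ ∷ _ ∷ kx) (_ ∷ _ ∷ ky) → p-zero x y (p≡0 x kx) (p≡0 y ky) (isotropic iso x y kx ky) }
      ; injective = λ { x (q₁ ∷ q₂ ∷ kx) z → injective iso x kx ((p≡0 x kx , cong₂ _,_ q₁ q₂) , z) }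
      })
    where
    p-zero : ∀ x y → p x ≡ 0K → p y ≡ 0K → hyperbolic (p , q) x y ⊕ B x y ≡ 0K → B x y ≡ 0K
    p-zero x y px≡0 py≡0 eq = begin
      B x y ≡⟨ ⊕-identityˡ (B x y) ⟨
      0K ⊕ B x y ≡⟨ cong (_⊕ B x y) (cong₂ _⊕_ (⊙-zeroˡ (q y)) (⊙-zeroʳ (q x))) ⟨
      (0K ⊙ q y ⊕ q x ⊙ 0K) ⊕ B x y ≡⟨ cong₂ (λ u v → (u ⊙ q y ⊕ q x ⊙ v) ⊕ B x y) px≡0 py≡0 ⟨
      hyperbolic (p , q) x y ⊕ B x y ≡⟨ eq ⟩
      0K ∎
      where open ≡-Reasoning

    p-nonvanishing : ∀ u → Kernel A u → p u ≢ 0K → ⊥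
    p-nonvanishing u ku pu≢0 = none ((proj₁ ∘ p) ∷ (proj₂ ∘ p) ∷ A , refl , record
      { linear = lp₁ ∷ lp₂ ∷ linear iso
      ; isotropic = λ { x y (p₁ ∷ p₂ ∷ kx) (p₁′ ∷ p₂′ ∷ ky) →
          p-zero x y (cong₂ _,_ p₁ p₂) (cong₂ _,_ p₁′ p₂′) (isotropic iso x y kx ky) }
      ; injective = λ { x (p₁ ∷ p₂ ∷ kx) z →
          injective iso x kx ((cong₂ _,_ p₁ p₂ , q-zero x (cong₂ _,_ p₁ p₂) z (isotropic iso x u kx ku)) , z) }
      })
      where
      q-zero : ∀ x → p x ≡ 0K → Z x → hyperbolic (p , q) x u ⊕ B x u ≡ 0K → q x ≡ 0K
      q-zero x px≡0 z eq = ⊙-cancelʳ (q x) (p u) pu≢0 (begin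
        q x ⊙ p u ≡⟨ ⊕-identityˡ (q x ⊙ p u) ⟨
        0K ⊕ q x ⊙ p u ≡⟨ cong (_⊕ q x ⊙ p u) (⊙-zeroˡ (q u)) ⟨
        0K ⊙ q u ⊕ q x ⊙ p u ≡⟨ cong (λ v → v ⊙ q u ⊕ q x ⊙ p u) px≡0 ⟨
        hyperbolic (p , q) x u ≡⟨ ⊕-identityʳ _ ⟨
        hyperbolic (p , q) x u ⊕ 0K ≡⟨ cong (hyperbolic (p , q) x u ⊕_) (Z⇒B≡0 x u z) ⟨
        hyperbolic (p , q) x u ⊕ B x u ≡⟨ eq ⟩
        0K ∎)
        where open ≡-Reasoning

    -- No `u` with `p u ≢ 0K` is searched for: every such `u` refutes `none`, and decidable equality
    -- in `K` turns the absence of one into an equation.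
    p≡0 : ∀ x → Kernel A x → p x ≡ 0K
    p≡0 x kx = decidable-stable (p x ≟K 0K) (p-nonvanishing x kx)

  ⟂-vanish : ∀ {n} {B : Form n} {Z : Vector n → Set} → (∀ x y → Z x → B x y ≡ 0K) →
    ∀ Ps x y → All (VanishAt x) Ps × Z x → (Ps ⟂ B) x y ≡ 0K
  ⟂-vanish Z⇒B≡0 [] x y ([] , z) = Z⇒B≡0 x y z
  ⟂-vanish {B = B} Z⇒B≡0 ((p , q) ∷ Ps) x y ((px≡0 , qx≡0) ∷ vs , z) = begin
    (p x ⊙ q y ⊕ q x ⊙ p y) ⊕ (Ps ⟂ B) x y ≡⟨ cong₂ (λ u v → (u ⊙ q y ⊕ v ⊙ p y) ⊕ (Ps ⟂ B) x y) px≡0 qx≡0 ⟩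
    (0K ⊙ q y ⊕ 0K ⊙ p y) ⊕ (Ps ⟂ B) x y ≡⟨ cong₂ _⊕_ (cong₂ _⊕_ (⊙-zeroˡ (q y)) (⊙-zeroˡ (p y))) (⟂-vanish Z⇒B≡0 Ps x y (vs , z)) ⟩
    0K ∎
    where open ≡-Reasoning

  -- In each step the planes still present belong to the residual form, so the hypothesis on `B` has
  -- to be extended to them by `⟂-vanish`. Each plane adds exactly two constraints.
  remove-planes : ∀ {n} {B : Form n} {Z : Vector n → Set} → (∀ x y → Z x → B x y ≡ 0K) →
    ∀ {A} Ps → All LinearPlane Ps → Isotropic A (Ps ⟂ B) (λ x → All (VanishAt x) Ps × Z x) →
    ¬ ¬ (∃[ A′ ] (length A′ ≡ length Ps ℕ.* 2 ℕ.+ length A × Isotropic A′ B Z))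
  remove-planes Z⇒B≡0 {A} [] _ iso none = none (A , refl , record
    { linear = linear iso ; isotropic = isotropic iso ; injective = λ x kx z → injective iso x kx ([] , z) })
  remove-planes Z⇒B≡0 {A} ((p , q) ∷ Ps) ((lp , lq) ∷ ls) iso none =
    remove-plane p q lp lq (⟂-vanish Z⇒B≡0 Ps)
      (record { linear = linear iso ; isotropic = isotropic iso
              ; injective = λ { x kx (v , vs , z) → injective iso x kx (v ∷ vs , z) } })
      λ (A′ , len′ , iso′) → remove-planes Z⇒B≡0 Ps ls iso′
      λ (A″ , len″ , iso″) → none (A″ , trans len″
        (trans (cong (length Ps ℕ.* 2 ℕ.+_) len′) (shift (length Ps ℕ.* 2) (length A))) , iso″)
    where
    shift : ∀ m n → m ℕ.+ (2 ℕ.+ n) ≡ 2 ℕ.+ m ℕ.+ n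
    shift m n = trans (sym (ℕₚ.+-assoc m 2 n)) (cong (ℕ._+ n) (ℕₚ.+-comm m 2))

-- Eight squares as four hyperbolic planes

module Blocks (k : ℕ) (0<k : 0 ℕ.< k) (a b c d e : ℤ) (e≢0 : e ≢ 0ℤ) (four-squares : + k * e ² ≡ a ² + b ² + c ² + d ²) where
  open ImaginaryQuadratic k 0<k

  -- This number plays two parts that must agree: it is the similarity factor of the quaternion
  -- matrix of (a,b,c,d), and minus the square of e √(- k). The first turns four squares, up to the
  -- factor, into Σ m²; the second splits each norm z² + m² over K.
  norm : ℤ
  norm = + k * e ²

  norm≢0 : norm ≢ 0ℤ
  norm≢0 = *-nonzero k≢0 (*-nonzero e≢0 e≢0)

  -- Four planes add up to - 2 (norm Σ z² + Σ m²), and Σ m² is `norm` times the other four squares;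
  -- this is the common factor of all eight.
  scale : ℤ
  scale = - (+ 2 * norm)

  scale≢0 : scale ≢ 0ℤ
  scale≢0 eq = *-nonzero {+ 2} (λ ()) norm≢0 (trans (sym (ℤₚ.neg-involutive _)) (cong -_ eq))

  infixr 7 _•_
  _•_ : ℤ → K → K
  s • (i , j) = s * i , s * j

  rowK : (r₀ r₁ r₂ r₃ : ℤ) (u₀ u₁ u₂ u₃ : K) → K
  rowK r₀ r₁ r₂ r₃ (w , w′) (x , x′) (y , y′) (z , z′) = row r₀ r₁ r₂ r₃ w x y z , row r₀ r₁ r₂ r₃ w′ x′ y′ z′

  minus plus : K → K → K
  minus (m , m′) (z , z′) = - (+ k * e * z′) - m , e * z - m′
  plus (m , m′) (z , z′) = - (+ k * e * z′) + m , e * z + m′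

  hyperbolicK : (m z n w : K) → K
  hyperbolicK m z n w = minus m z ⊙ plus n w ⊕ plus m z ⊙ minus n w

  -- With ε = e √(− k), these are the isotropic coordinates ε z ∓ m of the form − 2 (norm z² + m²), ε² = − norm.
  plane : ∀ {n} → (m z : Functional n) → Plane n
  plane m z = (λ x → minus (m x) (z x)) , (λ x → plus (m x) (z x))

  hyperbolic-plane₁ : ∀ m m′ z z′ n n′ w w′ →
    proj₁ (hyperbolicK (m , m′) (z , z′) (n , n′) (w , w′)) ≡
    - + 2 * (norm * (z * w - + k * (z′ * w′)) + (m * n - + k * (m′ * n′)))
  hyperbolic-plane₁ m m′ z z′ n n′ w w′ = identity m m′ z z′ n n′ w w′ (+ k) e
    where
    identity : ∀ m m′ z z′ n n′ w w′ k e →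
      (- (k * e * z′) - m) * (- (k * e * w′) + n) - k * ((e * z - m′) * (e * w + n′)) +
      ((- (k * e * z′) + m) * (- (k * e * w′) - n) - k * ((e * z + m′) * (e * w - n′))) ≡
      - + 2 * (k * (e * e) * (z * w - k * (z′ * w′)) + (m * n - k * (m′ * n′)))
    identity = solve-∀

  hyperbolic-plane₂ : ∀ m m′ z z′ n n′ w w′ →
    proj₂ (hyperbolicK (m , m′) (z , z′) (n , n′) (w , w′)) ≡
    - + 2 * (norm * (z * w′ + z′ * w) + (m * n′ + m′ * n))
  hyperbolic-plane₂ m m′ z z′ n n′ w w′ = identity m m′ z z′ n n′ w w′ (+ k) e
    where
    identity : ∀ m m′ z z′ n n′ w w′ k e →
      (- (k * e * z′) - m) * (e * w + n′) + (e * z - m′) * (- (k * e * w′) + n) +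
      ((- (k * e * z′) + m) * (e * w - n′) + (e * z + m′) * (- (k * e * w′) - n)) ≡
      - + 2 * (k * (e * e) * (z * w′ + z′ * w) + (m * n′ + m′ * n))
    identity = solve-∀

  -- Abstract integers stand for the products, so that the same identity serves the real and the
  -- imaginary part and the row polynomials stay folded.
  block-sum : ∀ {h₀ h₁ h₂ h₃ μ₀ μ₁ μ₂ μ₃ r} s₀ s₁ s₂ s₃ s₄ s₅ s₆ s₇ R →
    h₀ ≡ - + 2 * (norm * s₄ + μ₀) → h₁ ≡ - + 2 * (norm * s₅ + μ₁) →
    h₂ ≡ - + 2 * (norm * s₆ + μ₂) → h₃ ≡ - + 2 * (norm * s₇ + μ₃) →
    μ₀ + μ₁ + μ₂ + μ₃ ≡ norm * (s₀ + s₁ + s₂ + s₃) → r ≡ scale * R →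
    h₀ + (h₁ + (h₂ + (h₃ + r))) ≡ scale * (s₀ + (s₁ + (s₂ + (s₃ + (s₄ + (s₅ + (s₆ + (s₇ + R))))))))
  block-sum {h₀} {h₁} {h₂} {h₃} {μ₀} {μ₁} {μ₂} {μ₃} {r} s₀ s₁ s₂ s₃ s₄ s₅ s₆ s₇ R e₀ e₁ e₂ e₃ eμ er = begin
    h₀ + (h₁ + (h₂ + (h₃ + r)))
      ≡⟨ cong₂ _+_ e₀ (cong₂ _+_ e₁ (cong₂ _+_ e₂ (cong₂ _+_ e₃ er))) ⟩
    - + 2 * (norm * s₄ + μ₀) + (- + 2 * (norm * s₅ + μ₁) + (- + 2 * (norm * s₆ + μ₂) + (- + 2 * (norm * s₇ + μ₃) + scale * R)))
      ≡⟨ collect norm s₄ s₅ s₆ s₇ μ₀ μ₁ μ₂ μ₃ R ⟩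
    - + 2 * (norm * (s₄ + s₅ + s₆ + s₇) + (μ₀ + μ₁ + μ₂ + μ₃) + norm * R)
      ≡⟨ cong (λ μ → - + 2 * (norm * (s₄ + s₅ + s₆ + s₇) + μ + norm * R)) eμ ⟩
    - + 2 * (norm * (s₄ + s₅ + s₆ + s₇) + norm * (s₀ + s₁ + s₂ + s₃) + norm * R)
      ≡⟨ factor norm s₀ s₁ s₂ s₃ s₄ s₅ s₆ s₇ R ⟩
    scale * (s₀ + (s₁ + (s₂ + (s₃ + (s₄ + (s₅ + (s₆ + (s₇ + R)))))))) ∎
    where
    open ≡-Reasoning
    collect : ∀ N s₄ s₅ s₆ s₇ μ₀ μ₁ μ₂ μ₃ R →
      - + 2 * (N * s₄ + μ₀) + (- + 2 * (N * s₅ + μ₁) + (- + 2 * (N * s₆ + μ₂) + (- + 2 * (N * s₇ + μ₃) + - (+ 2 * N) * R))) ≡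
      - + 2 * (N * (s₄ + s₅ + s₆ + s₇) + (μ₀ + μ₁ + μ₂ + μ₃) + N * R)
    collect = solve-∀
    factor : ∀ N s₀ s₁ s₂ s₃ s₄ s₅ s₆ s₇ R →
      - + 2 * (N * (s₄ + s₅ + s₆ + s₇) + N * (s₀ + s₁ + s₂ + s₃) + N * R) ≡
      - (+ 2 * N) * (s₀ + (s₁ + (s₂ + (s₃ + (s₄ + (s₅ + (s₆ + (s₇ + R))))))))
    factor = solve-∀

  euler-norm : ∀ w x y z w′ x′ y′ z′ →
    row₀ a b c d w x y z * row₀ a b c d w′ x′ y′ z′ + row₁ a b c d w x y z * row₁ a b c d w′ x′ y′ z′ +
    row₂ a b c d w x y z * row₂ a b c d w′ x′ y′ z′ + row₃ a b c d w x y z * row₃ a b c d w′ x′ y′ z′ ≡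
    norm * (w * w′ + x * x′ + y * y′ + z * z′)
  euler-norm w x y z w′ x′ y′ z′ = trans (euler-polarised a b c d w x y z w′ x′ y′ z′)
    (cong (_* (w * w′ + x * x′ + y * y′ + z * z′)) (sym four-squares))

  -- The matrix of the rows has integer entries, so it acts on real and imaginary parts separately.
  -- The real part of a product in K therefore combines two instances of `euler-norm`, one in α and
  -- σ, the other in β and τ.
  block-products₁ : ∀ α₀ α₁ α₂ α₃ β₀ β₁ β₂ β₃ σ₀ σ₁ σ₂ σ₃ τ₀ τ₁ τ₂ τ₃ →
    α₀ + α₁ + α₂ + α₃ ≡ norm * (σ₀ + σ₁ + σ₂ + σ₃) → β₀ + β₁ + β₂ + β₃ ≡ norm * (τ₀ + τ₁ + τ₂ + τ₃) →
    (α₀ - + k * β₀) + (α₁ - + k * β₁) + (α₂ - + k * β₂) + (α₃ - + k * β₃) ≡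
    norm * ((σ₀ - + k * τ₀) + (σ₁ - + k * τ₁) + (σ₂ - + k * τ₂) + (σ₃ - + k * τ₃))
  block-products₁ α₀ α₁ α₂ α₃ β₀ β₁ β₂ β₃ σ₀ σ₁ σ₂ σ₃ τ₀ τ₁ τ₂ τ₃ eα eβ =
    trans (collect α₀ α₁ α₂ α₃ β₀ β₁ β₂ β₃ (+ k)) (trans (cong₂ (λ α β → α - + k * β) eα eβ)
      (factor norm σ₀ σ₁ σ₂ σ₃ τ₀ τ₁ τ₂ τ₃ (+ k)))
    where
    collect : ∀ α₀ α₁ α₂ α₃ β₀ β₁ β₂ β₃ k →
      (α₀ - k * β₀) + (α₁ - k * β₁) + (α₂ - k * β₂) + (α₃ - k * β₃) ≡ α₀ + α₁ + α₂ + α₃ - k * (β₀ + β₁ + β₂ + β₃)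
    collect = solve-∀
    factor : ∀ N σ₀ σ₁ σ₂ σ₃ τ₀ τ₁ τ₂ τ₃ k → N * (σ₀ + σ₁ + σ₂ + σ₃) - k * (N * (τ₀ + τ₁ + τ₂ + τ₃)) ≡
      N * ((σ₀ - k * τ₀) + (σ₁ - k * τ₁) + (σ₂ - k * τ₂) + (σ₃ - k * τ₃))
    factor = solve-∀

  block-products₂ : ∀ α₀ α₁ α₂ α₃ β₀ β₁ β₂ β₃ σ₀ σ₁ σ₂ σ₃ τ₀ τ₁ τ₂ τ₃ →
    α₀ + α₁ + α₂ + α₃ ≡ norm * (σ₀ + σ₁ + σ₂ + σ₃) → β₀ + β₁ + β₂ + β₃ ≡ norm * (τ₀ + τ₁ + τ₂ + τ₃) →
    (α₀ + β₀) + (α₁ + β₁) + (α₂ + β₂) + (α₃ + β₃) ≡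
    norm * ((σ₀ + τ₀) + (σ₁ + τ₁) + (σ₂ + τ₂) + (σ₃ + τ₃))
  block-products₂ α₀ α₁ α₂ α₃ β₀ β₁ β₂ β₃ σ₀ σ₁ σ₂ σ₃ τ₀ τ₁ τ₂ τ₃ eα eβ =
    trans (collect α₀ α₁ α₂ α₃ β₀ β₁ β₂ β₃) (trans (cong₂ _+_ eα eβ) (factor norm σ₀ σ₁ σ₂ σ₃ τ₀ τ₁ τ₂ τ₃))
    where
    collect : ∀ α₀ α₁ α₂ α₃ β₀ β₁ β₂ β₃ →
      (α₀ + β₀) + (α₁ + β₁) + (α₂ + β₂) + (α₃ + β₃) ≡ α₀ + α₁ + α₂ + α₃ + (β₀ + β₁ + β₂ + β₃)
    collect = solve-∀
    factor : ∀ N σ₀ σ₁ σ₂ σ₃ τ₀ τ₁ τ₂ τ₃ → N * (σ₀ + σ₁ + σ₂ + σ₃) + N * (τ₀ + τ₁ + τ₂ + τ₃) ≡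
      N * ((σ₀ + τ₀) + (σ₁ + τ₁) + (σ₂ + τ₂) + (σ₃ + τ₃))
    factor = solve-∀

  block-planes : ∀ {n} → (z₀ z₁ z₂ z₃ z₄ z₅ z₆ z₇ : Functional n) → List (Plane n) → List (Plane n)
  block-planes z₀ z₁ z₂ z₃ z₄ z₅ z₆ z₇ Ps =
    plane (λ x → rowK a b c d (z₀ x) (z₁ x) (z₂ x) (z₃ x)) z₄ ∷
    plane (λ x → rowK (- b) a d (- c) (z₀ x) (z₁ x) (z₂ x) (z₃ x)) z₅ ∷
    plane (λ x → rowK (- c) (- d) a b (z₀ x) (z₁ x) (z₂ x) (z₃ x)) z₆ ∷
    plane (λ x → rowK (- d) c (- b) a (z₀ x) (z₁ x) (z₂ x) (z₃ x)) z₇ ∷ Ps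

  diagonal : ∀ {m n} → (Fin m → Functional n) → Form n → Form n
  diagonal {zero} w B = B
  diagonal {suc m} w B x y = w zero x ⊙ w zero y ⊕ diagonal (w ∘ suc) B x y

  block-values : ∀ (u₀ u₁ u₂ u₃ u₄ u₅ u₆ u₇ v₀ v₁ v₂ v₃ v₄ v₅ v₆ v₇ S R : K) → S ≡ scale • R →
    hyperbolicK (rowK a b c d u₀ u₁ u₂ u₃) u₄ (rowK a b c d v₀ v₁ v₂ v₃) v₄ ⊕
    (hyperbolicK (rowK (- b) a d (- c) u₀ u₁ u₂ u₃) u₅ (rowK (- b) a d (- c) v₀ v₁ v₂ v₃) v₅ ⊕
    (hyperbolicK (rowK (- c) (- d) a b u₀ u₁ u₂ u₃) u₆ (rowK (- c) (- d) a b v₀ v₁ v₂ v₃) v₆ ⊕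
    (hyperbolicK (rowK (- d) c (- b) a u₀ u₁ u₂ u₃) u₇ (rowK (- d) c (- b) a v₀ v₁ v₂ v₃) v₇ ⊕
    S))) ≡ scale • (u₀ ⊙ v₀ ⊕ (u₁ ⊙ v₁ ⊕ (u₂ ⊙ v₂ ⊕ (u₃ ⊙ v₃ ⊕ (u₄ ⊙ v₄ ⊕ (u₅ ⊙ v₅ ⊕ (u₆ ⊙ v₆ ⊕ (u₇ ⊙ v₇ ⊕ R))))))))
  block-values (p₀ , q₀) (p₁ , q₁) (p₂ , q₂) (p₃ , q₃) (p₄ , q₄) (p₅ , q₅) (p₆ , q₆) (p₇ , q₇)
    (r₀ , s₀) (r₁ , s₁) (r₂ , s₂) (r₃ , s₃) (r₄ , s₄) (r₅ , s₅) (r₆ , s₆) (r₇ , s₇) (S₁ , S₂) (R₁ , R₂) eq = cong₂ _,_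
    (block-sum (p₀ * r₀ - + k * (q₀ * s₀)) (p₁ * r₁ - + k * (q₁ * s₁))
      (p₂ * r₂ - + k * (q₂ * s₂)) (p₃ * r₃ - + k * (q₃ * s₃))
      (p₄ * r₄ - + k * (q₄ * s₄)) (p₅ * r₅ - + k * (q₅ * s₅))
      (p₆ * r₆ - + k * (q₆ * s₆)) (p₇ * r₇ - + k * (q₇ * s₇)) R₁
      (hyperbolic-plane₁ (row₀ a b c d p₀ p₁ p₂ p₃) (row₀ a b c d q₀ q₁ q₂ q₃) p₄ q₄
        (row₀ a b c d r₀ r₁ r₂ r₃) (row₀ a b c d s₀ s₁ s₂ s₃) r₄ s₄)
      (hyperbolic-plane₁ (row₁ a b c d p₀ p₁ p₂ p₃) (row₁ a b c d q₀ q₁ q₂ q₃) p₅ q₅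
        (row₁ a b c d r₀ r₁ r₂ r₃) (row₁ a b c d s₀ s₁ s₂ s₃) r₅ s₅)
      (hyperbolic-plane₁ (row₂ a b c d p₀ p₁ p₂ p₃) (row₂ a b c d q₀ q₁ q₂ q₃) p₆ q₆
        (row₂ a b c d r₀ r₁ r₂ r₃) (row₂ a b c d s₀ s₁ s₂ s₃) r₆ s₆)
      (hyperbolic-plane₁ (row₃ a b c d p₀ p₁ p₂ p₃) (row₃ a b c d q₀ q₁ q₂ q₃) p₇ q₇
        (row₃ a b c d r₀ r₁ r₂ r₃) (row₃ a b c d s₀ s₁ s₂ s₃) r₇ s₇)
      (block-products₁
        (row₀ a b c d p₀ p₁ p₂ p₃ * row₀ a b c d r₀ r₁ r₂ r₃)
        (row₁ a b c d p₀ p₁ p₂ p₃ * row₁ a b c d r₀ r₁ r₂ r₃)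
        (row₂ a b c d p₀ p₁ p₂ p₃ * row₂ a b c d r₀ r₁ r₂ r₃)
        (row₃ a b c d p₀ p₁ p₂ p₃ * row₃ a b c d r₀ r₁ r₂ r₃)
        (row₀ a b c d q₀ q₁ q₂ q₃ * row₀ a b c d s₀ s₁ s₂ s₃)
        (row₁ a b c d q₀ q₁ q₂ q₃ * row₁ a b c d s₀ s₁ s₂ s₃)
        (row₂ a b c d q₀ q₁ q₂ q₃ * row₂ a b c d s₀ s₁ s₂ s₃)
        (row₃ a b c d q₀ q₁ q₂ q₃ * row₃ a b c d s₀ s₁ s₂ s₃)
        (p₀ * r₀) (p₁ * r₁) (p₂ * r₂) (p₃ * r₃) (q₀ * s₀) (q₁ * s₁) (q₂ * s₂) (q₃ * s₃)
        (euler-norm p₀ p₁ p₂ p₃ r₀ r₁ r₂ r₃) (euler-norm q₀ q₁ q₂ q₃ s₀ s₁ s₂ s₃))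
      (cong proj₁ eq))
    (block-sum (p₀ * s₀ + q₀ * r₀) (p₁ * s₁ + q₁ * r₁)
      (p₂ * s₂ + q₂ * r₂) (p₃ * s₃ + q₃ * r₃)
      (p₄ * s₄ + q₄ * r₄) (p₅ * s₅ + q₅ * r₅)
      (p₆ * s₆ + q₆ * r₆) (p₇ * s₇ + q₇ * r₇) R₂
      (hyperbolic-plane₂ (row₀ a b c d p₀ p₁ p₂ p₃) (row₀ a b c d q₀ q₁ q₂ q₃) p₄ q₄
        (row₀ a b c d r₀ r₁ r₂ r₃) (row₀ a b c d s₀ s₁ s₂ s₃) r₄ s₄)
      (hyperbolic-plane₂ (row₁ a b c d p₀ p₁ p₂ p₃) (row₁ a b c d q₀ q₁ q₂ q₃) p₅ q₅
        (row₁ a b c d r₀ r₁ r₂ r₃) (row₁ a b c d s₀ s₁ s₂ s₃) r₅ s₅)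
      (hyperbolic-plane₂ (row₂ a b c d p₀ p₁ p₂ p₃) (row₂ a b c d q₀ q₁ q₂ q₃) p₆ q₆
        (row₂ a b c d r₀ r₁ r₂ r₃) (row₂ a b c d s₀ s₁ s₂ s₃) r₆ s₆)
      (hyperbolic-plane₂ (row₃ a b c d p₀ p₁ p₂ p₃) (row₃ a b c d q₀ q₁ q₂ q₃) p₇ q₇
        (row₃ a b c d r₀ r₁ r₂ r₃) (row₃ a b c d s₀ s₁ s₂ s₃) r₇ s₇)
      (block-products₂
        (row₀ a b c d p₀ p₁ p₂ p₃ * row₀ a b c d s₀ s₁ s₂ s₃)
        (row₁ a b c d p₀ p₁ p₂ p₃ * row₁ a b c d s₀ s₁ s₂ s₃)
        (row₂ a b c d p₀ p₁ p₂ p₃ * row₂ a b c d s₀ s₁ s₂ s₃)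
        (row₃ a b c d p₀ p₁ p₂ p₃ * row₃ a b c d s₀ s₁ s₂ s₃)
        (row₀ a b c d q₀ q₁ q₂ q₃ * row₀ a b c d r₀ r₁ r₂ r₃)
        (row₁ a b c d q₀ q₁ q₂ q₃ * row₁ a b c d r₀ r₁ r₂ r₃)
        (row₂ a b c d q₀ q₁ q₂ q₃ * row₂ a b c d r₀ r₁ r₂ r₃)
        (row₃ a b c d q₀ q₁ q₂ q₃ * row₃ a b c d r₀ r₁ r₂ r₃)
        (p₀ * s₀) (p₁ * s₁) (p₂ * s₂) (p₃ * s₃) (q₀ * r₀) (q₁ * r₁) (q₂ * r₂) (q₃ * r₃)
        (euler-norm p₀ p₁ p₂ p₃ s₀ s₁ s₂ s₃) (euler-norm q₀ q₁ q₂ q₃ r₀ r₁ r₂ r₃))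
      (cong proj₂ eq))

  planes : ∀ {n} t → (Fin (t ℕ.* 8) → Functional n) → List (Plane n)
  planes zero w = []
  planes (suc t) w = block-planes (w 0F) (w 1F) (w 2F) (w 3F) (w 4F) (w 5F) (w 6F) (w 7F) (planes t (λ i → w (8 Fin.↑ʳ i)))

  planes-length : ∀ {n} t (w : Fin (t ℕ.* 8) → Functional n) → length (planes t w) ≡ t ℕ.* 4
  planes-length zero w = refl
  planes-length (suc t) w = cong (4 ℕ.+_) (planes-length t (λ i → w (8 Fin.↑ʳ i)))

  -- The tail form carries the factor `scale` as well, so that the whole sum of squares acquires a
  -- single factor.
  planes-form : ∀ {n} t (w : Fin (t ℕ.* 8) → Functional n) B x y →
    (planes t w ⟂ λ x y → scale • B x y) x y ≡ scale • diagonal w B x y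
  planes-form zero w B x y = refl
  planes-form (suc t) w B x y = block-values (w 0F x) (w 1F x) (w 2F x) (w 3F x) (w 4F x) (w 5F x) (w 6F x) (w 7F x)
    (w 0F y) (w 1F y) (w 2F y) (w 3F y) (w 4F y) (w 5F y) (w 6F y) (w 7F y)
    ((planes t (λ i → w (8 Fin.↑ʳ i)) ⟂ λ x y → scale • B x y) x y) (diagonal (λ i → w (8 Fin.↑ʳ i)) B x y)
    (planes-form t (λ i → w (8 Fin.↑ʳ i)) B x y)

  plane-linear : ∀ {n} r₀ r₁ r₂ r₃ {z₀ z₁ z₂ z₃ z : Functional n} →
    LinearK z₀ → LinearK z₁ → LinearK z₂ → LinearK z₃ → LinearK z →
    LinearPlane (plane (λ x → rowK r₀ r₁ r₂ r₃ (z₀ x) (z₁ x) (z₂ x) (z₃ x)) z)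
  plane-linear r₀ r₁ r₂ r₃ (l₀ , l₀′) (l₁ , l₁′) (l₂ , l₂′) (l₃ , l₃′) (l , l′) =
    (linear-- multiple-l′ row-l , linear-- multiple-l row-l′) , (linear-+ multiple-l′ row-l , linear-+ multiple-l row-l′)
    where
    row-l = linear-row r₀ r₁ r₂ r₃ l₀ l₁ l₂ l₃
    row-l′ = linear-row r₀ r₁ r₂ r₃ l₀′ l₁′ l₂′ l₃′
    multiple-l = linear-* e l
    multiple-l′ = linear-neg (linear-* (+ k * e) l′)

  planes-linear : ∀ {n} t (w : Fin (t ℕ.* 8) → Functional n) → (∀ i → LinearK (w i)) → All LinearPlane (planes t w)
  planes-linear zero w l = []
  planes-linear (suc t) w l =
    plane-linear a b c d (l 0F) (l 1F) (l 2F) (l 3F) (l 4F) ∷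
    plane-linear (- b) a d (- c) (l 0F) (l 1F) (l 2F) (l 3F) (l 5F) ∷
    plane-linear (- c) (- d) a b (l 0F) (l 1F) (l 2F) (l 3F) (l 6F) ∷
    plane-linear (- d) c (- b) a (l 0F) (l 1F) (l 2F) (l 3F) (l 7F) ∷
    planes-linear t (λ i → w (8 Fin.↑ʳ i)) (λ i → l (8 Fin.↑ʳ i))

  plane-vanish : ∀ m z → minus m z ≡ 0K → plus m z ≡ 0K → m ≡ 0K × z ≡ 0K
  plane-vanish (m , m′) (z , z′) eq₁ eq₂
    with kez′≡0 , m≡0 ← difference-sum≡0 (- (+ k * e * z′)) m (cong proj₁ eq₁) (cong proj₁ eq₂)
       | ez≡0 , m′≡0 ← difference-sum≡0 (e * z) m′ (cong proj₂ eq₁) (cong proj₂ eq₂)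
    = cong₂ _,_ m≡0 m′≡0 , cong₂ _,_
        ([ (λ e≡0 → contradiction e≡0 e≢0) , id ]′ (ℤₚ.i*j≡0⇒i≡0∨j≡0 e ez≡0))
        ([ (λ ke≡0 → contradiction ke≡0 (*-nonzero k≢0 e≢0)) , id ]′
          (ℤₚ.i*j≡0⇒i≡0∨j≡0 (+ k * e) (trans (sym (ℤₚ.neg-involutive _)) (cong -_ kez′≡0))))

  -- Euler's identity makes `norm` times the sum of the four squares zero, and that sum is definite
  -- over ℤ. Over K it is not, which is why `rowsK-vanish` treats the two parts separately.
  rows-vanish : ∀ w x y z → row₀ a b c d w x y z ≡ 0ℤ → row₁ a b c d w x y z ≡ 0ℤ →
    row₂ a b c d w x y z ≡ 0ℤ → row₃ a b c d w x y z ≡ 0ℤ → w ≡ 0ℤ × x ≡ 0ℤ × y ≡ 0ℤ × z ≡ 0ℤ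
  rows-vanish w x y z e₀ e₁ e₂ e₃ = sum-squares≡0 {w} {x} {y} {z}
    ([ (λ n≡0 → contradiction n≡0 norm≢0) , id ]′ (ℤₚ.i*j≡0⇒i≡0∨j≡0 norm (trans (sym (euler-norm w x y z w x y z))
      (cong₂ _+_ (cong₂ _+_ (cong₂ _+_ (cong _² e₀) (cong _² e₁)) (cong _² e₂)) (cong _² e₃)))))

  rowsK-vanish : ∀ u₀ u₁ u₂ u₃ → rowK a b c d u₀ u₁ u₂ u₃ ≡ 0K → rowK (- b) a d (- c) u₀ u₁ u₂ u₃ ≡ 0K →
    rowK (- c) (- d) a b u₀ u₁ u₂ u₃ ≡ 0K → rowK (- d) c (- b) a u₀ u₁ u₂ u₃ ≡ 0K →
    u₀ ≡ 0K × u₁ ≡ 0K × u₂ ≡ 0K × u₃ ≡ 0K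
  rowsK-vanish (w , w′) (x , x′) (y , y′) (z , z′) e₀ e₁ e₂ e₃ = pair
    (rows-vanish w x y z (cong proj₁ e₀) (cong proj₁ e₁) (cong proj₁ e₂) (cong proj₁ e₃))
    (rows-vanish w′ x′ y′ z′ (cong proj₂ e₀) (cong proj₂ e₁) (cong proj₂ e₂) (cong proj₂ e₃))
    where
    pair : w ≡ 0ℤ × x ≡ 0ℤ × y ≡ 0ℤ × z ≡ 0ℤ → w′ ≡ 0ℤ × x′ ≡ 0ℤ × y′ ≡ 0ℤ × z′ ≡ 0ℤ →
      (w , w′) ≡ 0K × (x , x′) ≡ 0K × (y , y′) ≡ 0K × (z , z′) ≡ 0K
    pair (w≡0 , x≡0 , y≡0 , z≡0) (w′≡0 , x′≡0 , y′≡0 , z′≡0) =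
      cong₂ _,_ w≡0 w′≡0 , cong₂ _,_ x≡0 x′≡0 , cong₂ _,_ y≡0 y′≡0 , cong₂ _,_ z≡0 z′≡0

  planes-vanish : ∀ {n} t (w : Fin (t ℕ.* 8) → Functional n) x → All (VanishAt x) (planes t w) → ∀ i → w i x ≡ 0K
  planes-vanish (suc t) w x ((p₀ , q₀) ∷ (p₁ , q₁) ∷ (p₂ , q₂) ∷ (p₃ , q₃) ∷ vs) =
    let m₀ , z₄ = plane-vanish (rowK a b c d (w 0F x) (w 1F x) (w 2F x) (w 3F x)) (w 4F x) p₀ q₀
        m₁ , z₅ = plane-vanish (rowK (- b) a d (- c) (w 0F x) (w 1F x) (w 2F x) (w 3F x)) (w 5F x) p₁ q₁
        m₂ , z₆ = plane-vanish (rowK (- c) (- d) a b (w 0F x) (w 1F x) (w 2F x) (w 3F x)) (w 6F x) p₂ q₂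
        m₃ , z₇ = plane-vanish (rowK (- d) c (- b) a (w 0F x) (w 1F x) (w 2F x) (w 3F x)) (w 7F x) p₃ q₃
        z₀ , z₁ , z₂ , z₃ = rowsK-vanish (w 0F x) (w 1F x) (w 2F x) (w 3F x) m₀ m₁ m₂ m₃
    in λ { 0F → z₀ ; 1F → z₁ ; 2F → z₂ ; 3F → z₃ ; 4F → z₄ ; 5F → z₅ ; 6F → z₆ ; 7F → z₇
         ; (suc (suc (suc (suc (suc (suc (suc (suc i)))))))) → planes-vanish t (λ i → w (8 Fin.↑ʳ i)) x vs i }

  diagonal-∑ : ∀ {m n} (w : Fin m → Functional n) B x y →
    diagonal w B x y ≡ (∑ (λ i → proj₁ (w i x ⊙ w i y)) + proj₁ (B x y) , ∑ (λ i → proj₂ (w i x ⊙ w i y)) + proj₂ (B x y))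
  diagonal-∑ {zero} w B x y = sym (⊕-identityˡ (B x y))
  diagonal-∑ {suc m} w B x y = trans (cong (w zero x ⊙ w zero y ⊕_) (diagonal-∑ (w ∘ suc) B x y))
    (cong₂ _,_ (sym (ℤₚ.+-assoc (proj₁ (w zero x ⊙ w zero y)) _ _)) (sym (ℤₚ.+-assoc (proj₂ (w zero x ⊙ w zero y)) _ _)))

  •-zero : ∀ s → s • 0K ≡ 0K
  •-zero s = cong₂ _,_ (ℤₚ.*-zeroʳ s) (ℤₚ.*-zeroʳ s)

  •-cancel : ∀ s → s ≢ 0ℤ → ∀ u → s • u ≡ 0K → u ≡ 0K
  •-cancel s s≢0 (x , y) eq = cong₂ _,_ (cancel x (cong proj₁ eq)) (cancel y (cong proj₂ eq))
    where
    cancel : ∀ x → s * x ≡ 0ℤ → x ≡ 0ℤ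
    cancel x e = [ (λ s≡0 → contradiction s≡0 s≢0) , id ]′ (ℤₚ.i*j≡0⇒i≡0∨j≡0 s e)

  real-part : ∀ y₀ x₀ y₁ x₁ y₂ x₂ y₃ x₃ →
    (y₀ * y₀ - + k * (x₀ * x₀)) + ((y₁ * y₁ - + k * (x₁ * x₁)) + ((y₂ * y₂ - + k * (x₂ * x₂)) + ((y₃ * y₃ - + k * (x₃ * x₃)) + 0ℤ))) ≡ 0ℤ →
    y₀ ² + y₁ ² + y₂ ² + y₃ ² ≡ + k * (x₀ ² + x₁ ² + x₂ ² + x₃ ²)
  real-part y₀ x₀ y₁ x₁ y₂ x₂ y₃ x₃ eq =
    ℤₚ.i-j≡0⇒i≡j (y₀ ² + y₁ ² + y₂ ² + y₃ ²) (+ k * (x₀ ² + x₁ ² + x₂ ² + x₃ ²))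
      (trans (collect y₀ x₀ y₁ x₁ y₂ x₂ y₃ x₃ (+ k)) eq)
    where
    collect : ∀ y₀ x₀ y₁ x₁ y₂ x₂ y₃ x₃ k →
      y₀ * y₀ + y₁ * y₁ + y₂ * y₂ + y₃ * y₃ - k * (x₀ * x₀ + x₁ * x₁ + x₂ * x₂ + x₃ * x₃) ≡
      (y₀ * y₀ - k * (x₀ * x₀)) + ((y₁ * y₁ - k * (x₁ * x₁)) + ((y₂ * y₂ - k * (x₂ * x₂)) + ((y₃ * y₃ - k * (x₃ * x₃)) + 0ℤ)))
    collect = solve-∀

  imaginary-part : ∀ y₀ x₀ y₁ x₁ y₂ x₂ y₃ x₃ →
    (y₀ * x₀ + x₀ * y₀) + ((y₁ * x₁ + x₁ * y₁) + ((y₂ * x₂ + x₂ * y₂) + ((y₃ * x₃ + x₃ * y₃) + 0ℤ))) ≡ 0ℤ →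
    x₀ * y₀ + x₁ * y₁ + x₂ * y₂ + x₃ * y₃ ≡ 0ℤ
  imaginary-part y₀ x₀ y₁ x₁ y₂ x₂ y₃ x₃ eq = [ (λ ()) , id ]′ (ℤₚ.i*j≡0⇒i≡0∨j≡0 (+ 2)
    (trans (collect y₀ x₀ y₁ x₁ y₂ x₂ y₃ x₃) eq))
    where
    collect : ∀ y₀ x₀ y₁ x₁ y₂ x₂ y₃ x₃ → + 2 * (x₀ * y₀ + x₁ * y₁ + x₂ * y₂ + x₃ * y₃) ≡
      (y₀ * x₀ + x₀ * y₀) + ((y₁ * x₁ + x₁ * y₁) + ((y₂ * x₂ + x₂ * y₂) + ((y₃ * x₃ + x₃ * y₃) + 0ℤ)))
    collect = solve-∀

  -- The case distinction is on x alone: the real part reads |y|² = k |x|², so x = 0 forces y = 0.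
  no-isotropic-quadruple : ¬ SumOfThreeSquares k → ∀ y₀ x₀ y₁ x₁ y₂ x₂ y₃ x₃ →
    (y₀ , x₀) ⊙ (y₀ , x₀) ⊕ ((y₁ , x₁) ⊙ (y₁ , x₁) ⊕ ((y₂ , x₂) ⊙ (y₂ , x₂) ⊕ ((y₃ , x₃) ⊙ (y₃ , x₃) ⊕ 0K))) ≡ 0K →
    (y₀ ≡ 0ℤ × y₁ ≡ 0ℤ × y₂ ≡ 0ℤ × y₃ ≡ 0ℤ) × (x₀ ≡ 0ℤ × x₁ ≡ 0ℤ × x₂ ≡ 0ℤ × x₃ ≡ 0ℤ)
  no-isotropic-quadruple not-three y₀ x₀ y₁ x₁ y₂ x₂ y₃ x₃ eq with x₀ ² + x₁ ² + x₂ ² + x₃ ² ℤₚ.≟ 0ℤ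
  ... | yes X≡0 = sum-squares≡0 {y₀} {y₁} {y₂} {y₃}
          (trans (real-part y₀ x₀ y₁ x₁ y₂ x₂ y₃ x₃ (cong proj₁ eq)) (trans (cong (+ k *_) X≡0) (ℤₚ.*-zeroʳ (+ k))))
        , sum-squares≡0 {x₀} {x₁} {x₂} {x₃} X≡0
  ... | no X≢0 = contradiction
          (orthogonal-similar⇒three-squares k x₀ x₁ x₂ x₃ y₀ y₁ y₂ y₃
            (imaginary-part y₀ x₀ y₁ x₁ y₂ x₂ y₃ x₃ (cong proj₂ eq)) (real-part y₀ x₀ y₁ x₁ y₂ x₂ y₃ x₃ (cong proj₁ eq)) X≢0)
          not-three

  -- The contradiction in order 4 + 8t

  module _ (not-three : ¬ SumOfThreeSquares k) (t : ℕ) (W : Matrix (4 ℕ.+ t ℕ.* 8))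
    (weighing : IsWeighingMatrix (4 ℕ.+ t ℕ.* 8) k W) (skew : IsSkewSymmetric W) where

    N : ℕ
    N = 4 ℕ.+ t ℕ.* 8

    -- The coordinates of W x + √(− k) x, an eigenvector of W.
    coordinate : Fin N → Functional N
    coordinate i x = (W · x) i , x i

    coordinate-linear : ∀ i → LinearK (coordinate i)
    coordinate-linear i = (W i , λ _ → refl) , linear-coordinate i

    rest : Fin (t ℕ.* 8) → Functional N
    rest i = coordinate (4 Fin.↑ʳ i)

    first-four : Form N
    first-four x y = coordinate 0F x ⊙ coordinate 0F y ⊕ (coordinate 1F x ⊙ coordinate 1F y ⊕
      (coordinate 2F x ⊙ coordinate 2F y ⊕ (coordinate 3F x ⊙ coordinate 3F y ⊕ 0K)))

    FirstFourVanish : Vector N → Set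
    FirstFourVanish x = coordinate 0F x ≡ 0K × coordinate 1F x ≡ 0K × coordinate 2F x ≡ 0K × coordinate 3F x ≡ 0K

    total-isotropic : ∀ x y → diagonal rest first-four x y ≡ 0K
    total-isotropic x y = trans (diagonal-∑ rest first-four x y) (cong₂ _,_
      (reorder (λ i → proj₁ (coordinate i x ⊙ coordinate i y)) (weighing-form weighing skew x y))
      (reorder (λ i → proj₂ (coordinate i x ⊙ coordinate i y)) (skew-form skew x y)))
      where
      move-last : ∀ f₀ f₁ f₂ f₃ r → r + (f₀ + (f₁ + (f₂ + (f₃ + 0ℤ)))) ≡ f₀ + (f₁ + (f₂ + (f₃ + r)))
      move-last = solve-∀
      reorder : (f : Fin N → ℤ) → ∑ f ≡ 0ℤ → ∑ (λ i → f (4 Fin.↑ʳ i)) + (f 0F + (f 1F + (f 2F + (f 3F + 0ℤ)))) ≡ 0ℤ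
      reorder f eq = trans (move-last (f 0F) (f 1F) (f 2F) (f 3F) (∑ (λ i → f (4 Fin.↑ʳ i)))) eq

    scaled-vanish : ∀ x y → FirstFourVanish x → scale • first-four x y ≡ 0K
    scaled-vanish x y (e₀ , e₁ , e₂ , e₃) = trans (cong (scale •_) (cong₂ _⊕_ (zeroˡ 0F e₀) (cong₂ _⊕_ (zeroˡ 1F e₁)
      (cong₂ _⊕_ (zeroˡ 2F e₂) (cong (_⊕ 0K) (zeroˡ 3F e₃)))))) (•-zero scale)
      where
      zeroˡ : ∀ i → coordinate i x ≡ 0K → coordinate i x ⊙ coordinate i y ≡ 0K
      zeroˡ i e = trans (cong (_⊙ coordinate i y) e) (⊙-zeroˡ (coordinate i y))

    -- The constraint list is empty because every x gives an eigenvector. Injectivity holds because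
    -- x is recovered as the imaginary parts of the coordinates.
    start : Isotropic [] (planes t rest ⟂ λ x y → scale • first-four x y)
      (λ x → All (VanishAt x) (planes t rest) × FirstFourVanish x)
    start = record
      { linear = []
      ; isotropic = λ x y _ _ → trans (planes-form t rest first-four x y)
          (trans (cong (scale •_) (total-isotropic x y)) (•-zero scale))
      ; injective = λ { x _ (vs , e₀ , e₁ , e₂ , e₃) →
          λ { 0F → cong proj₂ e₀ ; 1F → cong proj₂ e₁ ; 2F → cong proj₂ e₂ ; 3F → cong proj₂ e₃
            ; (suc (suc (suc (suc i)))) → cong proj₂ (planes-vanish t rest x vs i) } }
      }

    -- The 4t planes leave 8t constraints on 8t + 4 integer variables, hence a nonzero x in the
    -- kernel. The first four coordinates of its eigenvector form an isotropic quadruple, which must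
    -- vanish, and by injectivity x vanishes too.
    no-weighing : ⊥
    no-weighing = remove-planes scaled-vanish (planes t rest) (planes-linear t rest (λ i → coordinate-linear (4 Fin.↑ʳ i))) start
      λ (A , len , iso) →
        let x , kx , x≢0 = underdetermined-system A (Isotropic.linear iso) (few A len)
            isotropic = •-cancel scale scale≢0 (first-four x x) (Isotropic.isotropic iso x x kx kx)
            (y₀ , y₁ , y₂ , y₃) , (x₀ , x₁ , x₂ , x₃) = no-isotropic-quadruple not-three ((W · x) 0F) (x 0F) ((W · x) 1F) (x 1F)
              ((W · x) 2F) (x 2F) ((W · x) 3F) (x 3F) isotropic
        in x≢0 (Isotropic.injective iso x kx (cong₂ _,_ y₀ x₀ , cong₂ _,_ y₁ x₁ , cong₂ _,_ y₂ x₂ , cong₂ _,_ y₃ x₃))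
      where
      few : ∀ (A : List (Vector N → ℤ)) → length A ≡ length (planes t rest) ℕ.* 2 ℕ.+ 0 → length A ℕ.< N
      few A len = subst (ℕ._< N) (sym (trans len (trans (cong (λ l → l ℕ.* 2 ℕ.+ 0) (planes-length t rest)) (double t))))
        (s≤s (ℕₚ.m≤n+m (t ℕ.* 8) 3))
        where
        double : ∀ t → t ℕ.* 4 ℕ.* 2 ℕ.+ 0 ≡ t ℕ.* 8
        double = ℕ-solver.solve-∀

theorem2p10 : (k : ℕ) → 0 ℕ.< k → ¬ SumOfThreeSquares k →
    (t : ℕ) → ¬ (∃[ W ] (IsWeighingMatrix (4 ℕ.* (2 ℕ.* t ℕ.+ 1)) k W × IsSkewSymmetric W))
theorem2p10 k 0<k not-three t (W , weighing , skew) = regroup (order t) W weighing skew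
  where
  -- The shape 4 + t * 8 lets indices compute: four coordinates in front, then t blocks of eight.
  order : ∀ t → 4 ℕ.* (2 ℕ.* t ℕ.+ 1) ≡ 4 ℕ.+ t ℕ.* 8
  order = ℕ-solver.solve-∀
  regroup : ∀ {m} → m ≡ 4 ℕ.+ t ℕ.* 8 → (W : Matrix m) → IsWeighingMatrix m k W → IsSkewSymmetric W → ⊥
  regroup refl W weighing skew with e , a , b , c , d , e≢0 , eq ← four-rational-squares k 0<k =
    Blocks.no-weighing k 0<k a b c d e e≢0 eq not-three t W weighing skew
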